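{- Let $G$ be a biconnected Eulerian graph and let $G_1,G_2,\dots,G_k$ be its 2.5-connected components. Then (a) $c(G)=\sum_{i=1}^k c(G_i)-k+1$, and (b) $\nu(G)=\sum_{i=1}^k \nu(G_i)-k+1$.
   Context: Graphs are finite, may have parallel edges (a pair of parallel edges forms a cycle of length 2), and have no loops. A graph is biconnected if it is connected and for every triple of distinct vertices $u,v,w$ there is a $u$-$v$-path avoiding $w$. A cycle decomposition of $G$ is a set of cycles in $G$ such that each edge lies in exactly one of them. For an Eulerian graph $G$, $c(G)$ and $\nu(G)$ denote the minimum and maximum number of cycles in a cycle decomposition of $G$. Virtual edges: new edges created by splits, labelled so that the two edges created by one split correspond. For a biconnected graph $G$ that is not a triangle, $(c,uv)\in V(G)\times E(G)$ is a vertex-edge-separator if $G-uv-c$ is disconnected; then $G-uv-c$ has exactly two components, one containing $u$, one containing $v$. For $a\in\{u,v\}$ let $C_a$ be the component containing $a$, $G_a=G[V(C_a)\cup\{c\}]$, and $b$ the other end of $uv$. If $|E(G_a)|\ge 2$, replacing $G$ by $G_a+ac$ and $G_b+ba+ac$ (the two new edges $ac$ being corresponding virtual edges; $ba$ is the original edge $uv$) is a 2.5-split. $G$ is 2.5-connected if it is biconnected with no vertex-edge-separator. Performing 2.5-splits repeatedly until none is possible yields 2.5-split components (triangles, multiedges with at least 3 edges, other 2.5-connected graphs); merging (gluing along corresponding virtual edges and deleting them) the triangles as much as possible into cycles, leaving the rest unchanged, yields the 2.5-connected components of $G$. -}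

module Defs where

open import Data.Nat using (ℕ; _≤_; _+_; _≟_)
open import Data.Nat.Divisibility using (_∣_)
open import Data.Fin using (Fin)
import Data.Fin as F
open import Data.List using (List; []; _∷_; _++_; length; lookup; filter; map; removeAt)
open import Data.List.Relation.Unary.All using (All)
open import Data.List.Relation.Unary.Unique.Propositional using (Unique)
open import Data.List.Relation.Binary.Permutation.Propositional using (_↭_)
open import Data.List.Membership.Propositional using (_∈_; _∉_)
import Data.List.Membership.DecPropositional as DecMem
open import Data.Product using (Σ; ∃; ∃-syntax; _×_; _,_; proj₁; proj₂)
open import Data.Sum using (_⊎_)
open import Data.Unit using (⊤)
open import Data.Empty using (⊥)
open import Relation.Nullary using (¬_; ¬?)
open import Relation.Nullary.Decidable using (_×-dec_)
open import Relation.Binary.PropositionalEquality using (_≡_; _≢_)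
open import Relation.Binary.Construct.Closure.ReflexiveTransitive using (Star)

open DecMem {A = ℕ} _≟_ using () renaming (_∈?_ to _∈ℕ?_)

-- Multigraphs.  Vertices are named by natural numbers; edges are the
-- entries of a list (so parallel edges are distinct list positions).
-- Every edge carries a label: original, or virtual with a label ℓ
-- (the two virtual edges created by one split carry the same ℓ).

data Label : Set where
  orig : Label
  virt : ℕ → Label

record Edge : Set where
  constructor edge
  field
    lab : Label
    src : ℕ
    tgt : ℕ
open Edge public

record Graph : Set where
  constructor graph
  field
    verts : List ℕ
    edges : List Edge
open Graph public

WF : Graph → Set
WF G = Unique (verts G)
     × All (λ ed → src ed ∈ verts G × tgt ed ∈ verts G × src ed ≢ tgt ed) (edges G)

Ed : Graph → Set
Ed G = Fin (length (edges G))

edgeOf : (G : Graph) → Ed G → Edge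
edgeOf G e = lookup (edges G) e

Joins : (G : Graph) → Ed G → ℕ → ℕ → Set
Joins G e x y = (src (edgeOf G e) ≡ x × tgt (edgeOf G e) ≡ y)
              ⊎ (src (edgeOf G e) ≡ y × tgt (edgeOf G e) ≡ x)

data Path (G : Graph) (okV : ℕ → Set) (okE : Ed G → Set) : ℕ → ℕ → Set where
  here : ∀ {x} → okV x → Path G okV okE x x
  step : ∀ {x y z} → okV x → (e : Ed G) → okE e → Joins G e x y
       → Path G okV okE y z → Path G okV okE x z

Connected : Graph → Set
Connected G = (verts G ≢ [])
  × (∀ x y → x ∈ verts G → y ∈ verts G → Path G (λ _ → ⊤) (λ _ → ⊤) x y)

Biconnected : Graph → Set
Biconnected G = Connected G
  × (∀ u v w → u ∈ verts G → v ∈ verts G → w ∈ verts G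
       → u ≢ v → u ≢ w → v ≢ w → Path G (λ z → z ≢ w) (λ _ → ⊤) u v)

degree : Graph → ℕ → ℕ
degree G v = length (filter (λ ed → src ed ≟ v) (edges G))
           + length (filter (λ ed → tgt ed ≟ v) (edges G))

Eulerian : Graph → Set
Eulerian G = ∀ v → v ∈ verts G → 2 ∣ degree G v

Linked : (G : Graph) → ℕ → List (Ed G × ℕ) → Set
Linked G first [] = ⊥
Linked G first ((e , v) ∷ []) = Joins G e v first
Linked G first ((e , v) ∷ (e' , v') ∷ ws) = Joins G e v v' × Linked G first ((e' , v') ∷ ws)

Closed : (G : Graph) → List (Ed G × ℕ) → Set
Closed G [] = ⊥
Closed G ((e , v) ∷ ws) = Linked G v ((e , v) ∷ ws)

record Cycle (G : Graph) : Set where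
  field
    walk   : List (Ed G × ℕ)
    long   : 2 ≤ length walk
    uniqV  : Unique (map proj₂ walk)
    uniqE  : Unique (map proj₁ walk)
    closed : Closed G walk
open Cycle public

cycEdges : {G : Graph} → Cycle G → List (Ed G)
cycEdges C = map proj₁ (walk C)

IsCycleDecomposition : (G : Graph) → List (Cycle G) → Set
IsCycleDecomposition G D =
  ∀ (e : Ed G) → length (filter (λ C → DecMem._∈?_ F._≟_ e (cycEdges C)) D) ≡ 1

IsMinCD : Graph → ℕ → Set
IsMinCD G k = (∃[ D ] (IsCycleDecomposition G D × length D ≡ k))
            × (∀ D → IsCycleDecomposition G D → k ≤ length D)

IsMaxCD : Graph → ℕ → Set
IsMaxCD G k = (∃[ D ] (IsCycleDecomposition G D × length D ≡ k))
            × (∀ D → IsCycleDecomposition G D → length D ≤ k)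

IsTriangle : Graph → Set
IsTriangle G = length (verts G) ≡ 3 × length (edges G) ≡ 3
  × (∀ (e f : Ed G) → e ≢ f → ¬ Joins G f (src (edgeOf G e)) (tgt (edgeOf G e)))

PathAvoid : (G : Graph) → ℕ → Ed G → ℕ → ℕ → Set
PathAvoid G c e = Path G (λ z → z ≢ c) (λ f → f ≢ e)

VESeparator : (G : Graph) → ℕ → Ed G → Set
VESeparator G c e = Biconnected G × ¬ IsTriangle G × c ∈ verts G
  × ∃[ x ] ∃[ y ] (x ∈ verts G × y ∈ verts G × x ≢ c × y ≢ c × ¬ PathAvoid G c e x y)

IsComponent : (G : Graph) → ℕ → Ed G → ℕ → List ℕ → Set
IsComponent G c e a A = Unique A
  × (∀ x → x ∈ A → PathAvoid G c e a x) × (∀ x → PathAvoid G c e a x → x ∈ A)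

inside : List ℕ → List Edge → List Edge
inside S = filter (λ ed → (src ed ∈ℕ? S) ×-dec (tgt ed ∈ℕ? S))

-- the 2.5-split of G at the vertex-edge-separator (c , e), e = ab,
-- with new virtual label ℓ, yields H₁ = G_a + ac and H₂ = G_b + ba + ac
SplitOf : Graph → ℕ → Graph → Graph → Set
SplitOf G ℓ H₁ H₂ = ∃[ c ] Σ (Ed G) λ e → VESeparator G c e
  × ∃[ a ] ∃[ b ] (Joins G e a b
  × ∃[ A ] ∃[ B ] (IsComponent G c e a A × IsComponent G c e b B
  × 2 ≤ length (inside (c ∷ A) (edges G))
  × H₁ ≡ graph (c ∷ A) (inside (c ∷ A) (edges G) ++ edge (virt ℓ) a c ∷ [])
  × H₂ ≡ graph (a ∷ c ∷ B)
               (inside (c ∷ B) (edges G) ++ edgeOf G e ∷ edge (virt ℓ) a c ∷ [])))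

Splittable : Graph → Set
Splittable G = ∃[ ℓ ] ∃[ H₁ ] ∃[ H₂ ] SplitOf G ℓ H₁ H₂

FreshLabel : ℕ → List Graph → Set
FreshLabel ℓ s = All (λ P → All (λ ed → lab ed ≢ virt ℓ) (edges P)) s

SplitStep : List Graph → List Graph → Set
SplitStep s s' = ∃[ P ] ∃[ rest ] ∃[ ℓ ] ∃[ H₁ ] ∃[ H₂ ]
  (s ↭ P ∷ rest × FreshLabel ℓ s × SplitOf P ℓ H₁ H₂ × s' ≡ H₁ ∷ H₂ ∷ rest)

SplitComponents : Graph → List Graph → Set
SplitComponents G s = Star SplitStep (G ∷ []) s × All (λ P → ¬ Splittable P) s

renameE : (ℕ → ℕ) → Edge → Edge
renameE ρ (edge l x y) = edge l (ρ x) (ρ y)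

-- R is obtained by gluing P and Q along corresponding virtual edges i (in P)
-- and j (in Q): Q's vertices are renamed by ρ, injectively, identifying the
-- ends of j with the corresponding ends of i and all other vertices of Q with
-- new vertices; then both virtual edges are deleted.
Glue : Graph → Graph → Graph → Set
Glue P Q R = Σ (Ed P) λ i → Σ (Ed Q) λ j → ∃[ ℓ ] ∃[ ρ ]
  ( lab (edgeOf P i) ≡ virt ℓ × lab (edgeOf Q j) ≡ virt ℓ
  × ρ (src (edgeOf Q j)) ≡ src (edgeOf P i) × ρ (tgt (edgeOf Q j)) ≡ tgt (edgeOf P i)
  × (∀ x y → x ∈ verts Q → y ∈ verts Q → ρ x ≡ ρ y → x ≡ y)
  × (∀ x → x ∈ verts Q → x ≢ src (edgeOf Q j) → x ≢ tgt (edgeOf Q j) → ρ x ∉ verts P)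
  × R ≡ graph (verts P ++ map ρ (filter (λ x → ¬? (x ≟ src (edgeOf Q j)) ×-dec ¬? (x ≟ tgt (edgeOf Q j))) (verts Q)))
              (removeAt (edges P) i ++ map (renameE ρ) (removeAt (edges Q) j)))

HasVirtual : Graph → ℕ → Set
HasVirtual P ℓ = ∃[ ed ] (ed ∈ edges P × lab ed ≡ virt ℓ)

MergeStep : List Graph → List Graph → Set
MergeStep ts ts' = ∃[ P ] ∃[ Q ] ∃[ R ] ∃[ rest ]
  (ts ↭ P ∷ Q ∷ rest × Glue P Q R × ts' ≡ R ∷ rest)

MergeDone : List Graph → Set
MergeDone ts = ¬ (∃[ P ] ∃[ Q ] ∃[ rest ] ∃[ ℓ ]
  (ts ↭ P ∷ Q ∷ rest × HasVirtual P ℓ × HasVirtual Q ℓ))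

TwoHalfConnectedComponents : Graph → List Graph → Set
TwoHalfConnectedComponents G Cs = ∃[ s ] ∃[ ts ] ∃[ os ] ∃[ ts' ]
  ( SplitComponents G s
  × s ↭ ts ++ os × All IsTriangle ts × All (λ P → ¬ IsTriangle P) os
  × Star MergeStep ts ts' × MergeDone ts'
  × Cs ≡ ts' ++ os)

AllOriginal : Graph → Set
AllOriginal G = All (λ ed → lab ed ≡ orig) (edges G)

{-# OPTIONS --safe #-}

-- Call a multiset of edges even if it meets every vertex an even number of times, and a
-- circuit if it is a minimal nonempty even multiset; a cycle decomposition is then a
-- partition of the edges into circuits.  Consider a 2.5-split at (c , ab).  A circuit of
-- G through ab restricts to G_a and to G_b; by the handshake lemma the virtual edge ac
-- (together with ab on the side of b) completes the restrictions to circuits of the two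
-- parts, and every other circuit of G lies on one side.  So the decompositions of G into
-- k circuits correspond to pairs of decompositions into k₁ and k₂ circuits, with
-- k₁ + k₂ = k + 1.  A triangle is itself a circuit, and gluing two circuits along an edge
-- yields a circuit, so merging preserves Σ c(G_i) - k: each term c(G_i) - 1 is 0.

module Submission where

open import Defs
open import Data.Bool using (Bool; true; false; not; _∧_; _xor_)
open import Data.Bool.Properties using (xor-comm; xor-assoc; xor-same; xor-identityʳ)
import Data.Bool.Properties as Bool
open import Data.Empty using (⊥-elim)
open import Data.Fin using (Fin; zero; suc)
import Data.Fin as F
open import Data.List using (List; []; _∷_; [_]; _++_; length; lookup; filter; map; removeAt; concat; allFin)
import Data.List.Properties as List
open import Data.List.Membership.Propositional using (_∈_; _∉_)
import Data.List.Membership.DecPropositional as DecMem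
open import Data.List.Membership.Propositional.Properties
  using (∈-concat⁻′; ∈-map⁺; ∈-map⁻; ∈-++⁺ˡ; ∈-++⁺ʳ; ∈-++⁻; ∈-filter⁺; ∈-∃++; ∈-lookup; ∈-allFin)
open import Data.List.Membership.Propositional using (find; lose)
open import Data.List.Relation.Binary.Permutation.Propositional
  using (_↭_; refl; prep; swap; trans; ↭-refl; ↭-sym; ↭-reflexive; module PermutationReasoning)
open import Data.List.Relation.Binary.Permutation.Propositional.Properties
  using (All-resp-↭; ∈-resp-↭; map⁺; ↭-map-inv; ↭-length; ++⁺; ++⁺ˡ; ++⁺ʳ; shift; drop-∷; ++-comm;
         ↭-empty-inv; ¬x∷xs↭[]; filter-↭; ++-commutativeMonoid)
import Data.List.Relation.Binary.Permutation.Setoid.Properties as SetoidPermutation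
open import Data.List.Relation.Binary.Pointwise as Pointwise using (Pointwise; []; _∷_)
open import Data.List.Relation.Unary.All using (All; []; _∷_)
import Data.List.Relation.Unary.All as All
import Data.List.Relation.Unary.All.Properties as All
open import Data.List.Relation.Unary.AllPairs using ([]; _∷_)
open import Data.List.Relation.Unary.Any using (Any; here; there; any?; index)
open import Data.List.Relation.Unary.Any.Properties using (lookup-index)
open import Data.List.Relation.Unary.Unique.Propositional using (Unique)
import Data.List.Relation.Unary.Unique.Propositional.Properties as Unique
open import Data.Nat using (ℕ; zero; suc; _+_; _⊔_; _≤_; _<_; z≤n; s≤s; s≤s⁻¹; _≟_)
import Data.Nat.Properties as ℕ
open import Data.Nat.Divisibility using (_∣_; divides)
open import Data.Nat.ListAction using (sum)
open import Data.Nat.Tactic.RingSolver using (solve-∀)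
open import Data.Product using (Σ; ∃; ∃₂; ∃-syntax; _×_; _,_; proj₁; proj₂; -,_)
open import Data.Sum as Sum using (_⊎_; inj₁; inj₂; [_,_]′)
open import Data.Unit using (⊤)
open import Function using (_∘_; id; case_of_)
open import Relation.Binary.Construct.Closure.ReflexiveTransitive using (Star; ε; _◅_)
open import Relation.Binary.PropositionalEquality
  using (_≡_; _≢_; refl; sym; cong; cong₂; subst; subst₂; setoid; module ≡-Reasoning)
  renaming (trans to ≡-trans)
open import Relation.Nullary using (¬_; Dec; yes; no; does; contradiction)
open import Relation.Nullary.Decidable using (dec-true; dec-false; map′; _×-dec_; ¬?)

open DecMem _≟_ using () renaming (_∈?_ to _∈ℕ?_)

-- Edges are treated as a multiset, a list up to `↭`, because splits reorder positions and gluings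
-- rename vertices: cycles given by walks through positions would have to be rebuilt at every step.
-- Parity takes the place of walks, since evenness of a piece of a circuit can be checked vertex by
-- vertex. Walks return only in `Cycles`, which translates between cycle decompositions and circuits
-- of a fixed graph.
--
-- At a split the two sides share only c, so the parity of a piece is controlled at every vertex but
-- c, and a sum over all vertices supplies the missing one. What makes the correspondence reversible
-- is the vertex a: in the part that keeps ab, its only edges are ab and ac, so a circuit through ac
-- must also use ab.
--
-- The relation k₁ + k₂ = k + 1 holds for every pair of decompositions, not just for optimal ones,
-- so optimality passes to both parts by exchange. That optima exist at all is obtained
-- constructively, by deciding for each k whether a decomposition into k circuits exists.

-- Multisets as lists up to permutation

module _ {A : Set} where

  ∈⇒↭ : ∀ {x : A} {xs} → x ∈ xs → ∃[ xs' ] xs ↭ x ∷ xs'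
  ∈⇒↭ x∈ with us , vs , refl ← ∈-∃++ x∈ = us ++ vs , shift _ us vs

  ∷-split : ∀ {x : A} {zs} xs {ys} → x ∷ zs ↭ xs ++ ys
          → (∃[ xs' ] (xs ↭ x ∷ xs' × zs ↭ xs' ++ ys))
          ⊎ (∃[ ys' ] (ys ↭ x ∷ ys' × zs ↭ xs ++ ys'))
  ∷-split {x} xs {ys} p with ∈-++⁻ xs (∈-resp-↭ p (here refl))
  ... | inj₁ x∈ with xs' , q ← ∈⇒↭ x∈ =
    inj₁ (xs' , q , drop-∷ (trans p (++⁺ʳ ys q)))
  ... | inj₂ x∈ with ys' , q ← ∈⇒↭ x∈ =
    inj₂ (ys' , q , drop-∷ (trans p (trans (++⁺ˡ xs q) (shift x xs ys'))))

  -- Riesz refinement for multisets. It cuts a circuit, or an even part of one, along the two sides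
  -- of a split or of a gluing.
  record Refinement (as bs cs ds : List A) : Set where
    constructor refinement
    field
      {ac ad bc bd} : List A
      as↭ : as ↭ ac ++ ad
      bs↭ : bs ↭ bc ++ bd
      cs↭ : cs ↭ ac ++ bc
      ds↭ : ds ↭ ad ++ bd

  refine : ∀ as {bs} cs {ds : List A} → as ++ bs ↭ cs ++ ds → Refinement as bs cs ds
  refine [] cs p = refinement {ac = []} {ad = []} ↭-refl p ↭-refl ↭-refl
  refine (a ∷ as) cs p with ∷-split cs p
  ... | inj₁ (cs' , q , r) with refinement {ac} {ad} {bc} {bd} s t u v ← refine as cs' r =
    refinement {ac = a ∷ ac} {ad} {bc} {bd} (prep a s) t (trans q (prep a u)) v
  ... | inj₂ (ds' , q , r) with refinement {ac} {ad} {bc} {bd} s t u v ← refine as cs r =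
    refinement {ac = ac} {a ∷ ad} {bc} {bd} (trans (prep a s) (↭-sym (shift a ac ad))) t u
      (trans q (prep a v))

  ++-conical : ∀ (xs : List A) {ys zs} → zs ↭ xs ++ ys → xs ≡ [] → ys ≡ [] → zs ≡ []
  ++-conical .[] p refl refl = ↭-empty-inv p

  Unique-resp-↭ : ∀ {xs ys : List A} → xs ↭ ys → Unique xs → Unique ys
  Unique-resp-↭ p = SetoidPermutation.Unique-resp-↭ (setoid A) (↭⇒↭ₛ p)
    where open import Data.List.Relation.Binary.Permutation.Propositional using (↭⇒↭ₛ)

  Unique-++⁻ˡ : ∀ (xs : List A) {ys} → Unique (xs ++ ys) → Unique xs
  Unique-++⁻ˡ []       _       = []
  Unique-++⁻ˡ (x ∷ xs) (p ∷ u) = All.++⁻ˡ xs p ∷ Unique-++⁻ˡ xs u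

  Unique-++⁻ʳ : ∀ (xs : List A) {ys} → Unique (xs ++ ys) → Unique ys
  Unique-++⁻ʳ []       u       = u
  Unique-++⁻ʳ (x ∷ xs) (_ ∷ u) = Unique-++⁻ʳ xs u

  Unique-++⁻-disjoint : ∀ (xs : List A) {ys x} → Unique (xs ++ ys) → x ∈ xs → x ∉ ys
  Unique-++⁻-disjoint (x ∷ xs) (p ∷ _) (here refl) x∈ys = All.lookup p (∈-++⁺ʳ xs x∈ys) refl
  Unique-++⁻-disjoint (x ∷ xs) (_ ∷ u) (there x∈xs) x∈ys = Unique-++⁻-disjoint xs u x∈xs x∈ys

  same-members⇒↭ : ∀ {xs ys : List A} → Unique xs → Unique ys
    → (∀ x → x ∈ xs → x ∈ ys) → (∀ x → x ∈ ys → x ∈ xs) → xs ↭ ys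
  same-members⇒↭ {[]} {[]} _ _ _ _ = ↭-refl
  same-members⇒↭ {[]} {y ∷ ys} _ _ _ g = case g y (here refl) of λ ()
  same-members⇒↭ {x ∷ xs} {ys} (x∉ ∷ uxs) uys f g
    with ys' , p ← ∈⇒↭ (f x (here refl))
    with x∉' ∷ uys' ← Unique-resp-↭ p uys =
    trans (prep x (same-members⇒↭ uxs uys' f' g')) (↭-sym p)
    where
    f' : ∀ z → z ∈ xs → z ∈ ys'
    f' z z∈ with ∈-resp-↭ p (f z (there z∈))
    ... | here refl  = contradiction refl (All.lookup x∉ z∈)
    ... | there z∈' = z∈'
    g' : ∀ z → z ∈ ys' → z ∈ xs
    g' z z∈ with g z (∈-resp-↭ (↭-sym p) (there z∈))
    ... | here refl  = contradiction refl (All.lookup x∉' z∈)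
    ... | there z∈' = z∈'

  All-⊆ : ∀ {P : A → Set} {xs} ys {zs} → xs ↭ ys ++ zs → All P xs → All P ys × All P zs
  All-⊆ ys p = All.++⁻ ys ∘ All-resp-↭ p

  lookup-removeAt : ∀ (xs : List A) i → xs ↭ lookup xs i ∷ removeAt xs i
  lookup-removeAt (x ∷ xs) zero    = ↭-refl
  lookup-removeAt (x ∷ xs) (suc i) = trans (prep x (lookup-removeAt xs i)) (swap x _ ↭-refl)

  All-removeAt : ∀ {P : A → Set} (xs : List A) i
               → (∀ j → j ≢ i → P (lookup xs j)) → All P (removeAt xs i)
  All-removeAt {P} (x ∷ xs) zero h = All.tabulate λ x∈ → subst P (sym (lookup-index x∈)) (h (suc (index x∈)) λ ())
  All-removeAt (x ∷ xs) (suc i) h = h zero (λ ()) ∷ All-removeAt xs i (λ j j≢i → h (suc j) (j≢i ∘ λ { refl → refl }))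

map-++⁻ : ∀ {A B : Set} (f : A → B) zs xs {ys} → map f zs ≡ xs ++ ys
        → ∃₂ λ xs' ys' → zs ≡ xs' ++ ys' × xs ≡ map f xs' × ys ≡ map f ys'
map-++⁻ f zs       []       e = [] , zs , refl , refl , sym e
map-++⁻ f (z ∷ zs) (x ∷ xs) e with List.∷-injective e
... | refl , e' with xs' , ys' , refl , refl , eq ← map-++⁻ f zs xs e' = z ∷ xs' , ys' , refl , refl , eq

concat-map⁻ : ∀ {A B : Set} (f : A → B) L zs → concat L ≡ map f zs
            → ∃[ M ] (L ≡ map (map f) M × zs ≡ concat M)
concat-map⁻ f []      []  _ = [] , refl , refl
concat-map⁻ f (X ∷ L) zs e
  with xs , ys , refl , refl , eq ← map-++⁻ f zs X (sym e)
  with M , refl , refl ← concat-map⁻ f L ys eq = xs ∷ M , refl , refl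

-- Parity of edge multisets and the handshake lemma

δ : ℕ → ℕ → Bool
δ x v = does (x ≟ v)

δ-refl : ∀ x → δ x x ≡ true
δ-refl x = dec-true (x ≟ x) refl

δ-≢ : ∀ {x v} → x ≢ v → δ x v ≡ false
δ-≢ {x} {v} = dec-false (x ≟ v)

-- The boundary of an edge with coefficients mod 2. `par` extends it to multisets, and `Even`
-- singles out the cycle space.
∂ : Edge → ℕ → Bool
∂ e v = δ (src e) v xor δ (tgt e) v

par : ℕ → List Edge → Bool
par v []       = false
par v (e ∷ es) = ∂ e v xor par v es

Even : List Edge → Set
Even es = ∀ v → par v es ≡ false

par-++ : ∀ v xs ys → par v (xs ++ ys) ≡ par v xs xor par v ys
par-++ v []       ys = refl
par-++ v (x ∷ xs) ys rewrite par-++ v xs ys = sym (xor-assoc (∂ x v) (par v xs) (par v ys))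

xor-swap : ∀ a b c → a xor (b xor c) ≡ b xor (a xor c)
xor-swap false b c = refl
xor-swap true false c = refl
xor-swap true true c = refl

xor≡false : ∀ {a b} → a xor b ≡ false → a ≡ b
xor≡false {false} {false} _ = refl
xor≡false {true}  {true}  _ = refl

par-↭ : ∀ v {xs ys} → xs ↭ ys → par v xs ≡ par v ys
par-↭ v refl         = refl
par-↭ v (prep x p)   = cong (∂ x v xor_) (par-↭ v p)
par-↭ v (swap {xs} x y p) = ≡-trans (xor-swap (∂ x v) (∂ y v) (par v xs))
  (cong (λ b → ∂ y v xor (∂ x v xor b)) (par-↭ v p))
par-↭ v (trans p q)  = ≡-trans (par-↭ v p) (par-↭ v q)

Even-↭ : ∀ {xs ys} → xs ↭ ys → Even xs → Even ys
Even-↭ p ev v = ≡-trans (sym (par-↭ v p)) (ev v)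

Even-++ : ∀ {xs ys} → Even xs → Even ys → Even (xs ++ ys)
Even-++ {xs} {ys} ex ey v = ≡-trans (par-++ v xs ys) (cong₂ _xor_ (ex v) (ey v))

Even-++ʳ : ∀ xs {ys} → Even (xs ++ ys) → Even xs → Even ys
Even-++ʳ xs {ys} e ex v = ≡-trans (cong (_xor par v ys) (sym (ex v))) (≡-trans (sym (par-++ v xs ys)) (e v))

Avoids : ℕ → Edge → Set
Avoids v e = src e ≢ v × tgt e ≢ v

Avoids⇒∂ : ∀ {v} e → Avoids v e → ∂ e v ≡ false
Avoids⇒∂ e (s , t) = cong₂ _xor_ (δ-≢ s) (δ-≢ t)

par-avoid : ∀ {v es} → All (Avoids v) es → par v es ≡ false
par-avoid []       = refl
par-avoid (_∷_ {x = e} s es) = cong₂ _xor_ (Avoids⇒∂ e s) (par-avoid es)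

xorSum : ℕ → (ℕ → Bool) → Bool
xorSum zero    f = false
xorSum (suc n) f = f n xor xorSum n f

xor-interchange : ∀ a b c d → (a xor b) xor (c xor d) ≡ (a xor c) xor (b xor d)
xor-interchange = solve 4 (λ a b c d → (a :+ b) :+ (c :+ d) := (a :+ c) :+ (b :+ d)) refl
  where
  open import Data.Bool.Solver
  open xor-∧-Solver

xorSum-xor : ∀ n f g → xorSum n (λ v → f v xor g v) ≡ xorSum n f xor xorSum n g
xorSum-xor zero    f g = refl
xorSum-xor (suc n) f g rewrite xorSum-xor n f g = xor-interchange (f n) (g n) (xorSum n f) (xorSum n g)

xorSum-false : ∀ n {f} → (∀ v → v < n → f v ≡ false) → xorSum n f ≡ false
xorSum-false zero    h = refl
xorSum-false (suc n) h = cong₂ _xor_ (h n ℕ.≤-refl) (xorSum-false n λ v v<n → h v (ℕ.m≤n⇒m≤1+n v<n))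

xorSum-single : ∀ n f c → c < n → (∀ v → v ≢ c → f v ≡ false) → xorSum n f ≡ f c
xorSum-single (suc n) f c (s≤s c≤n) h with n ≟ c
... | yes refl = ≡-trans (cong (f n xor_) (xorSum-false n λ v v<n → h v (ℕ.<⇒≢ v<n))) (xor-identityʳ (f n))
... | no n≢c = ≡-trans (cong (_xor xorSum n f) (h n n≢c))
                 (xorSum-single n f c (ℕ.≤∧≢⇒< c≤n (n≢c ∘ sym)) h)

xorSum-δ : ∀ n x → x < n → xorSum n (δ x) ≡ true
xorSum-δ n x x<n = ≡-trans (xorSum-single n (δ x) x x<n λ v v≢x → δ-≢ (v≢x ∘ sym)) (δ-refl x)

bound : List Edge → ℕ
bound []       = 0
bound (e ∷ es) = suc (src e) ⊔ suc (tgt e) ⊔ bound es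

-- The two ends of each edge cancel, provided that both lie in the range of summation.
handshake : ∀ n es → bound es ≤ n → xorSum n (λ v → par v es) ≡ false
handshake n []       _ = xorSum-false n λ _ _ → refl
handshake n (e ∷ es) b≤n = begin
  xorSum n (λ v → ∂ e v xor par v es)                      ≡⟨ xorSum-xor n (∂ e) (λ v → par v es) ⟩
  xorSum n (∂ e) xor xorSum n (λ v → par v es)             ≡⟨ cong₂ _xor_ edge-sum
                                                                (handshake n es (ℕ.m⊔n≤o⇒n≤o _ _ b≤n)) ⟩
  false                                                    ∎
  where
  open ≡-Reasoning
  e≤n = ℕ.m⊔n≤o⇒m≤o (suc (src e) ⊔ suc (tgt e)) (bound es) b≤n
  edge-sum : xorSum n (∂ e) ≡ false
  edge-sum = ≡-trans (xorSum-xor n (δ (src e)) (δ (tgt e)))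
    (cong₂ _xor_ (xorSum-δ n (src e) (ℕ.m⊔n≤o⇒m≤o (suc (src e)) (suc (tgt e)) e≤n))
                 (xorSum-δ n (tgt e) (ℕ.m⊔n≤o⇒n≤o (suc (src e)) (suc (tgt e)) e≤n)))

-- The parities sum to zero, so the one at `c` is forced by the others. This settles evenness at a
-- vertex where both sides have edges.
Even-except-one : ∀ c es → (∀ v → v ≢ c → par v es ≡ false) → Even es
Even-except-one c es h v with v ≟ c
... | no v≢c = h v v≢c
... | yes refl = ≡-trans (sym (xorSum-single n (λ v → par v es) v (ℕ.m≤m⊔n (suc v) (bound es)) h))
                   (handshake n es (ℕ.m≤n⊔m (suc v) (bound es)))
  -- Large enough for the handshake lemma and for `v` itself to be in the sum.
  where n = suc v ⊔ bound es

-- Circuits and decompositions of multisets of edges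

Circuit : List Edge → Set
Circuit C = C ≢ [] × Even C × (∀ X Y → C ↭ X ++ Y → Even X → X ≡ [] ⊎ Y ≡ [])

-- Forests. A circuit is an even multiset that becomes a forest when an edge is removed; in this
-- form it is easier to cut and join than as a minimal even multiset.
Acyclic : List Edge → Set
Acyclic es = ∀ X Y → es ↭ X ++ Y → Even X → X ≡ []

Decomposes : List Edge → ℕ → Set
Decomposes es k = ∃[ L ] (length L ≡ k × All Circuit L × es ↭ concat L)

Circuit-↭ : ∀ {C C'} → C ↭ C' → Circuit C → Circuit C'
Circuit-↭ p (ne , ev , mn) =
  (λ { refl → ne (↭-empty-inv p) }) , Even-↭ p ev , λ X Y q → mn X Y (trans p q)

Acyclic-↭ : ∀ {es es'} → es ↭ es' → Acyclic es → Acyclic es'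
Acyclic-↭ p ac X Y q = ac X Y (trans p q)

Decomposes-↭ : ∀ {es es' k} → es ↭ es' → Decomposes es k → Decomposes es' k
Decomposes-↭ p (L , l , cs , q) = L , l , cs , trans (↭-sym p) q

Acyclic-++ˡ : ∀ xs {ys} → Acyclic (xs ++ ys) → Acyclic xs
Acyclic-++ˡ xs {ys} ac X Y p = ac X (Y ++ ys) (trans (++⁺ʳ ys p) (↭-reflexive (List.++-assoc X Y ys)))

Acyclic-++ʳ : ∀ xs {ys} → Acyclic (xs ++ ys) → Acyclic ys
Acyclic-++ʳ xs {ys} ac = Acyclic-++ˡ ys (Acyclic-↭ (++-comm xs ys) ac)

-- Of two complementary even parts, one misses `e` and hence lies in the forest `es`.
circuit-intro : ∀ {e es} → Even (e ∷ es) → Acyclic es → Circuit (e ∷ es)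
circuit-intro {e} {es} ev ac = (λ ()) , ev , minimal
  where
  minimal : ∀ X Y → e ∷ es ↭ X ++ Y → Even X → X ≡ [] ⊎ Y ≡ []
  minimal X Y p eX with ∷-split X p
  ... | inj₁ (X' , _ , r) = inj₂ (ac Y X' (trans r (++-comm X' Y)) (Even-++ʳ X (Even-↭ p ev) eX))
  ... | inj₂ (Y' , _ , r) = inj₁ (ac X Y' r eX)

circuit-acyclic : ∀ {C e es} → Circuit C → C ↭ e ∷ es → Acyclic es
circuit-acyclic {e = e} (_ , _ , mn) p X Y q eX
  with mn X (e ∷ Y) (trans p (trans (prep e q) (↭-sym (shift e X Y)))) eX
... | inj₁ X≡[] = X≡[]

decomposes-even : ∀ {es k} → Decomposes es k → Even es
decomposes-even (L , _ , cs , p) = Even-↭ (↭-sym p) (go cs)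
  where
  go : ∀ {L} → All Circuit L → Even (concat L)
  go []                      v = refl
  go {C ∷ L} (c ∷ cs) v = Even-++ {C} {concat L} (proj₁ (proj₂ c)) (go cs) v

concat-↭ : ∀ {A : Set} {L L' : List (List A)} → L ↭ L' → concat L ↭ concat L'
concat-↭ refl = ↭-refl
concat-↭ (prep C p) = ++⁺ˡ C (concat-↭ p)
concat-↭ (swap {L} {L'} C D p) = trans (↭-reflexive (sym (List.++-assoc C D (concat L))))
  (trans (++⁺ (++-comm C D) (concat-↭ p)) (↭-reflexive (List.++-assoc D C (concat L'))))
concat-↭ (trans p q) = trans (concat-↭ p) (concat-↭ q)

∈-decomposition : ∀ {e es} L → e ∷ es ↭ concat L → All Circuit L
  → ∃₂ λ C L' → Circuit (e ∷ C) × All Circuit L' × length L ≡ suc (length L') × es ↭ C ++ concat L'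
∈-decomposition {e} L p cs with ∈-concat⁻′ L (∈-resp-↭ p (here refl))
... | D , e∈D , D∈L with C , q ← ∈⇒↭ e∈D | L' , r ← ∈⇒↭ D∈L with cD ∷ cs' ← All-resp-↭ r cs =
  C , L' , Circuit-↭ q cD , cs' , ↭-length r , drop-∷ (trans p (trans (concat-↭ r) (++⁺ʳ (concat L') q)))

-- Edge multisets that meet in one vertex

-- Stated by avoidance at each vertex rather than by vertex sets, so that it passes to submultisets
-- and yields vanishing parities directly.
record Separated (a b c : ℕ) (E₁ E₂ : List Edge) : Set where
  field
    apart : ∀ v → v ≢ c → All (Avoids v) E₁ ⊎ All (Avoids v) E₂
    a-off : All (Avoids a) E₂
    b-off : All (Avoids b) E₁
open Separated

Separated-⊆ : ∀ {a b c E₁ E₂} X₁ X₂ {Y₁ Y₂} → E₁ ↭ X₁ ++ Y₁ → E₂ ↭ X₂ ++ Y₂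
            → Separated a b c E₁ E₂ → Separated a b c X₁ X₂
Separated-⊆ X₁ X₂ p q s = record
  { apart = λ v v≢c → case apart s v v≢c of λ where
      (inj₁ h) → inj₁ (proj₁ (All-⊆ X₁ p h))
      (inj₂ h) → inj₂ (proj₁ (All-⊆ X₂ q h))
  ; a-off = proj₁ (All-⊆ X₂ q (a-off s))
  ; b-off = proj₁ (All-⊆ X₁ p (b-off s))
  }

-- Both sides have equal parity at each vertex, and off `c` one of them has no edge there; at `c`
-- the handshake lemma decides.
even-parts : ∀ {a b c} X Y → Separated a b c X Y → Even (X ++ Y) → Even X × Even Y
even-parts {c = c} X Y s ev = evX , Even-++ʳ X ev evX
  where
  X≡Y : ∀ v → par v X ≡ par v Y
  X≡Y v = xor≡false (≡-trans (sym (par-++ v X Y)) (ev v))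
  evX : Even X
  evX = Even-except-one c X λ v v≢c → case apart s v v≢c of λ where
    (inj₁ h) → par-avoid h
    (inj₂ h) → ≡-trans (X≡Y v) (par-avoid h)

acyclic-join : ∀ {a b c X Y} → Separated a b c X Y → Acyclic X → Acyclic Y → Acyclic (X ++ Y)
acyclic-join {X = X} {Y} s acX acY Z W p eZ
  with refinement {X₁} {X₂} {Y₁} {Y₂} X↭ Y↭ Z↭ _ ← refine X Z p
  with e₁ , e₂ ← even-parts X₁ Y₁ (Separated-⊆ X₁ Y₁ X↭ Y↭ s) (Even-↭ Z↭ eZ) =
  ++-conical X₁ Z↭ (acX X₁ X₂ X↭ e₁) (acY Y₁ Y₂ Y↭ e₂)

-- By `even-parts` each circuit is cut into two even pieces, and minimality empties one of them.
circuits-separate : ∀ {a b c} M₁ M₂ L → All Circuit L → concat L ↭ M₁ ++ M₂ → Separated a b c M₁ M₂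
  → ∃₂ λ L₁ L₂ → All Circuit L₁ × All Circuit L₂ × length L ≡ length L₁ + length L₂
               × M₁ ↭ concat L₁ × M₂ ↭ concat L₂
circuits-separate M₁ M₂ [] [] p s
  with refl ← List.++-conicalˡ M₁ _ (↭-empty-inv (↭-sym p)) | refl ← List.++-conicalʳ M₁ _ (↭-empty-inv (↭-sym p)) =
  [] , [] , [] , [] , refl , ↭-refl , ↭-refl
circuits-separate M₁ M₂ (C ∷ L) (cC ∷ cL) p s
  with refinement {X₁} {X₂} {Y₁} {Y₂} C↭ L↭ M₁↭ M₂↭ ← refine C M₁ p
  with L₁ , L₂ , c₁ , c₂ , l , p₁ , p₂ ← circuits-separate Y₁ Y₂ L cL L↭
         (Separated-⊆ Y₁ Y₂ (trans M₁↭ (++-comm X₁ Y₁)) (trans M₂↭ (++-comm X₂ Y₂)) s)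
  with proj₂ (proj₂ cC) X₁ X₂ C↭ (proj₁ (even-parts X₁ X₂ (Separated-⊆ X₁ X₂ M₁↭ M₂↭ s) (Even-↭ C↭ (proj₁ (proj₂ cC)))))
... | inj₁ refl = L₁ , C ∷ L₂ , c₁ , cC ∷ c₂ , ≡-trans (cong suc l) (sym (ℕ.+-suc (length L₁) (length L₂)))
                , trans M₁↭ p₁ , trans M₂↭ (++⁺ (↭-sym C↭) p₂)
... | inj₂ refl = C ∷ L₁ , L₂ , cC ∷ c₁ , c₂ , cong suc l
                , trans M₁↭ (++⁺ (↭-sym (trans C↭ (↭-reflexive (List.++-identityʳ X₁)))) p₁) , trans M₂↭ p₂

-- e is the split edge ab, f the virtual edge ac, and E₁, E₂ are the edges of G_a, G_b.
module Split {a b c : ℕ} {e f : Edge} (a≢b : a ≢ b) (a≢c : a ≢ c)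
  (∂e : ∀ v → ∂ e v ≡ δ a v xor δ b v) (∂f : ∀ v → ∂ f v ≡ δ a v xor δ c v) where

  ∂e-a : ∂ e a ≡ true
  ∂e-a = ≡-trans (∂e a) (cong₂ _xor_ (δ-refl a) (δ-≢ (a≢b ∘ sym)))

  ∂f-a : ∂ f a ≡ true
  ∂f-a = ≡-trans (∂f a) (cong₂ _xor_ (δ-refl a) (δ-≢ (a≢c ∘ sym)))

  -- At `a` the second side is absent and `f` takes over the role of `e`; at `b` the first side is
  -- absent; at any other vertex off `c` neither `e` nor `f` counts and only one side can be
  -- present.
  even₁ : ∀ {X₁ X₂} → Separated a b c X₁ X₂ → Even (e ∷ X₁ ++ X₂) → Even (f ∷ X₁)
  even₁ {X₁} {X₂} s ev = Even-except-one c (f ∷ X₁) go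
    where
    ev' : ∀ v → par v X₂ ≡ false → ∂ e v ≡ par v X₁
    ev' v h = xor≡false (≡-trans (cong (∂ e v xor_)
      (≡-trans (≡-trans (sym (xor-identityʳ (par v X₁))) (cong (par v X₁ xor_) (sym h))) (sym (par-++ v X₁ X₂)))) (ev v))
    go : ∀ v → v ≢ c → ∂ f v xor par v X₁ ≡ false
    go v v≢c with v ≟ a
    ... | yes refl = cong₂ _xor_ ∂f-a (≡-trans (sym (ev' v (par-avoid (a-off s)))) ∂e-a)
    ... | no v≢a = cong₂ _xor_ (≡-trans (∂f v) (cong₂ _xor_ (δ-≢ (v≢a ∘ sym)) (δ-≢ (v≢c ∘ sym)))) X₁-even
      where
      X₁-even : par v X₁ ≡ false
      X₁-even with apart s v v≢c | v ≟ b
      ... | inj₁ h | _ = par-avoid h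
      ... | inj₂ h | yes refl = par-avoid (b-off s)
      ... | inj₂ h | no v≢b = ≡-trans (sym (ev' v (par-avoid h)))
        (≡-trans (∂e v) (cong₂ _xor_ (δ-≢ (v≢a ∘ sym)) (δ-≢ (v≢b ∘ sym))))

  -- Evenness of `f ∷ X₁` says that `f` and `X₁` have the same boundary, so one may be substituted
  -- for the other.
  even₂ : ∀ {X₁ X₂} → Even (f ∷ X₁) → Even (e ∷ X₁ ++ X₂) → Even (f ∷ e ∷ X₂)
  even₂ {X₁} {X₂} h₁ h v rewrite xor≡false {∂ f v} (h₁ v) =
    ≡-trans (xor-swap (par v X₁) (∂ e v) (par v X₂)) (≡-trans (cong (∂ e v xor_) (sym (par-++ v X₁ X₂))) (h v))

  even-join : ∀ {X₁ X₂} → Even (f ∷ X₁) → Even (f ∷ e ∷ X₂) → Even (e ∷ X₁ ++ X₂)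
  even-join {X₁} {X₂} h₁ h₂ v rewrite par-++ v X₁ X₂ | sym (xor≡false {∂ f v} (h₁ v)) =
    ≡-trans (xor-swap (∂ e v) (∂ f v) (par v X₂)) (h₂ v)

  -- `e` is the only edge at `a` here, so an even part cannot contain it.
  acyclic-e∷ : ∀ {X₂} → All (Avoids a) X₂ → Acyclic X₂ → Acyclic (e ∷ X₂)
  acyclic-e∷ off ac X Y p eX with ∷-split X p
  ... | inj₂ (Y' , _ , r) = ac X Y' r eX
  ... | inj₁ (X' , q , r) = case ≡-trans (sym (eX a)) X-odd of λ ()
    where
    X-odd : par a X ≡ true
    X-odd = ≡-trans (par-↭ a q) (cong₂ _xor_ ∂e-a (par-avoid (proj₁ (All-⊆ X' r off))))

  split : ∀ {E₁ E₂ k} → Separated a b c E₁ E₂ → Decomposes (e ∷ E₁ ++ E₂) k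
        → ∃₂ λ m n → k ≡ suc (m + n) × Decomposes (f ∷ E₁) (suc m) × Decomposes (f ∷ e ∷ E₂) (suc n)
  split {E₁} {E₂} s (L , refl , cs , p)
    -- `C` is the circuit through `e` with `e` removed. Below, `X₁` and `X₂` are its traces on the
    -- two sides, and `M₁` and `M₂` are what remains for the other circuits.
    with C , L' , cC , cs' , l , q ← ∈-decomposition L p cs
    with refinement {X₁} {M₁} {X₂} {M₂} E₁↭ E₂↭ C↭ L'↭ ← refine E₁ C q
    with L₁ , L₂ , c₁ , c₂ , l' , p₁ , p₂ ← circuits-separate M₁ M₂ L' cs' L'↭
           (Separated-⊆ M₁ M₂ (trans E₁↭ (++-comm X₁ M₁)) (trans E₂↭ (++-comm X₂ M₂)) s) =
    length L₁ , length L₂ , ≡-trans l (cong suc l')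
    , ((f ∷ X₁) ∷ L₁ , refl , circuit-intro ev₁ (Acyclic-++ˡ X₁ acC) ∷ c₁
      , prep f (trans E₁↭ (++⁺ˡ X₁ p₁)))
    , ((f ∷ e ∷ X₂) ∷ L₂ , refl
      , circuit-intro (even₂ {X₁} {X₂} ev₁ evC) (acyclic-e∷ (a-off sX) (Acyclic-++ʳ X₁ acC)) ∷ c₂
      , prep f (prep e (trans E₂↭ (++⁺ˡ X₂ p₂))))
    where
    sX  = Separated-⊆ X₁ X₂ E₁↭ E₂↭ s
    acC = Acyclic-↭ C↭ (circuit-acyclic cC ↭-refl)
    evC = Even-↭ (prep e C↭) (proj₁ (proj₂ cC))
    ev₁ = even₁ {X₁} {X₂} sX evC

  join : ∀ {E₁ E₂ k₁ k₂} → Separated a b c E₁ E₂ → Decomposes (f ∷ E₁) k₁ → Decomposes (f ∷ e ∷ E₂) k₂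
       → ∃₂ λ m n → k₁ ≡ suc m × k₂ ≡ suc n × Decomposes (e ∷ E₁ ++ E₂) (suc (m + n))
  join {E₁} {E₂} s (L₁ , refl , c₁ , p₁) (L₂ , refl , c₂ , p₂)
    with X₁ , L₁' , cX₁ , c₁' , l₁ , q₁ ← ∈-decomposition L₁ p₁ c₁
    with Z , L₂' , cZ , c₂' , l₂ , q₂ ← ∈-decomposition L₂ p₂ c₂
    with ∷-split Z q₂
  -- A circuit through `f` that omits `e` would have odd parity at `a`.
  ... | inj₂ (_ , _ , r) = case ≡-trans (sym (proj₁ (proj₂ cZ) a))
          (cong₂ _xor_ ∂f-a (par-avoid (proj₁ (All-⊆ Z r (a-off s))))) of λ ()
  ... | inj₁ (X₂ , Z↭ , r) = length L₁' , length L₂' , l₁ , l₂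
      , (e ∷ X₁ ++ X₂) ∷ L₁' ++ L₂' , cong suc (List.length-++ L₁')
      , circuit-intro (even-join {X₁} {X₂} (proj₁ (proj₂ cX₁)) (Even-↭ (prep f Z↭) (proj₁ (proj₂ cZ))))
          (acyclic-join (Separated-⊆ X₁ X₂ q₁ r s) (circuit-acyclic cX₁ ↭-refl)
            (Acyclic-++ʳ [ e ] (circuit-acyclic cZ (prep f Z↭)))) ∷ All.++⁺ c₁' c₂'
      , prep e (begin
          E₁ ++ E₂                                      ↭⟨ ++⁺ q₁ r ⟩
          (X₁ ++ concat L₁') ++ (X₂ ++ concat L₂')      ↭⟨ interchange X₁ (concat L₁') X₂ (concat L₂') ⟩
          (X₁ ++ X₂) ++ (concat L₁' ++ concat L₂')      ≡⟨ cong ((X₁ ++ X₂) ++_) (List.concat-++ L₁' L₂') ⟩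
          (X₁ ++ X₂) ++ concat (L₁' ++ L₂')             ∎)
    where
    open PermutationReasoning
    interchange : ∀ (xs ys zs ws : List Edge) → (xs ++ ys) ++ (zs ++ ws) ↭ (xs ++ zs) ++ (ys ++ ws)
    interchange = solve 4 (λ xs ys zs ws → (xs ⊕ ys) ⊕ (zs ⊕ ws) ⊜ (xs ⊕ zs) ⊕ (ys ⊕ ws)) ↭-refl
      where open import Algebra.Solver.CommutativeMonoid (++-commutativeMonoid {A = Edge})

-- Existence of minimum and maximum decompositions

splits : List Edge → List (List Edge × List Edge)
splits []       = [ ([] , []) ]
splits (e ∷ es) = map (λ (X , Y) → e ∷ X , Y) (splits es) ++ map (λ (X , Y) → X , e ∷ Y) (splits es)

splits-sound : ∀ es {X Y} → (X , Y) ∈ splits es → es ↭ X ++ Y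
splits-sound [] (here refl) = ↭-refl
splits-sound (e ∷ es) m with ∈-++⁻ (map (λ (X , Y) → e ∷ X , Y) (splits es)) m
... | inj₁ m' with _ , m'' , refl ← ∈-map⁻ _ m' = prep e (splits-sound es m'')
... | inj₂ m' with (X , Y) , m'' , refl ← ∈-map⁻ _ m' =
  trans (prep e (splits-sound es m'')) (↭-sym (shift e X Y))

splits-complete : ∀ es X Y → es ↭ X ++ Y → ∃₂ λ X' Y' → (X' , Y') ∈ splits es × X ↭ X' × Y ↭ Y'
splits-complete [] X Y p
  with refl ← List.++-conicalˡ X Y (↭-empty-inv (↭-sym p)) | refl ← List.++-conicalʳ X Y (↭-empty-inv (↭-sym p)) =
  [] , [] , here refl , ↭-refl , ↭-refl
splits-complete (e ∷ es) X Y p with ∷-split X p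
... | inj₁ (X₁ , q , r) with X' , Y' , m , s , t ← splits-complete es X₁ Y r =
  e ∷ X' , Y' , ∈-++⁺ˡ (∈-map⁺ _ m) , trans q (prep e s) , t
... | inj₂ (Y₁ , q , r) with X' , Y' , m , s , t ← splits-complete es X Y₁ r =
  X' , e ∷ Y' , ∈-++⁺ʳ _ (∈-map⁺ _ m) , s , trans q (prep e t)

-- `splits` meets every partition only up to reordering of the two parts, which is why `P` has to
-- respect `↭`.
anySplit? : ∀ {P : List Edge → List Edge → Set} → (∀ X Y → Dec (P X Y))
  → (∀ {X X' Y Y'} → X ↭ X' → Y ↭ Y' → P X Y → P X' Y')
  → ∀ es → Dec (∃₂ λ X Y → es ↭ X ++ Y × P X Y)
anySplit? {P} P? resp es = map′ to from (any? (λ XY → P? (proj₁ XY) (proj₂ XY)) (splits es))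
  where
  to : Any (λ XY → P (proj₁ XY) (proj₂ XY)) (splits es) → ∃₂ λ X Y → es ↭ X ++ Y × P X Y
  to h with (X , Y) , m , pXY ← find h = X , Y , splits-sound es m , pXY
  from : (∃₂ λ X Y → es ↭ X ++ Y × P X Y) → Any (λ XY → P (proj₁ XY) (proj₂ XY)) (splits es)
  from (X , Y , p , pXY) with X' , Y' , m , s , t ← splits-complete es X Y p = lose m (resp s t pXY)

par-bound : ∀ v es → bound es ≤ v → par v es ≡ false
par-bound v []       _ = refl
par-bound v (e ∷ es) b≤v = cong₂ _xor_
  (Avoids⇒∂ e (ℕ.<⇒≢ (ℕ.m⊔n≤o⇒m≤o (suc (src e)) (suc (tgt e)) e≤v) , ℕ.<⇒≢ (ℕ.m⊔n≤o⇒n≤o (suc (src e)) (suc (tgt e)) e≤v)))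
  (par-bound v es (ℕ.m⊔n≤o⇒n≤o _ _ b≤v))
  where e≤v = ℕ.m⊔n≤o⇒m≤o (suc (src e) ⊔ suc (tgt e)) (bound es) b≤v

-- No edge has an end at or above `bound es`, so finitely many vertices remain to be checked.
even? : ∀ es → Dec (Even es)
even? es = map′ to (λ ev {v} _ → ev v) (ℕ.allUpTo? (λ v → par v es Bool.≟ false) (bound es))
  where
  to : (∀ {v} → v < bound es → par v es ≡ false) → Even es
  to h v with ℕ.≤-<-connex (bound es) v
  ... | inj₁ b≤v = par-bound v es b≤v
  ... | inj₂ v<b = h v<b

IsProperEvenSplit : List Edge → List Edge → Set
IsProperEvenSplit X Y = X ≢ [] × Y ≢ [] × Even X

properEvenSplit? : ∀ es → Dec (∃₂ λ X Y → es ↭ X ++ Y × IsProperEvenSplit X Y)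
properEvenSplit? = anySplit?
  (λ X Y → ¬? (empty? X) ×-dec ¬? (empty? Y) ×-dec even? X)
  (λ p q (ne , ne' , ev) → (λ { refl → ne (↭-empty-inv p) }) , (λ { refl → ne' (↭-empty-inv q) }) , Even-↭ p ev)
  where
  empty? : (es : List Edge) → Dec (es ≡ [])
  empty? []       = yes refl
  empty? (_ ∷ _)  = no λ ()

indecomposable⇒circuit : ∀ {es} → es ≢ [] → Even es
  → ¬ (∃₂ λ X Y → es ↭ X ++ Y × IsProperEvenSplit X Y) → Circuit es
indecomposable⇒circuit ne ev h = ne , ev , minimal
  where
  minimal : ∀ X Y → _ ↭ X ++ Y → Even X → X ≡ [] ⊎ Y ≡ []
  minimal []      Y       _ _  = inj₁ refl
  minimal (_ ∷ _) []      _ _  = inj₂ refl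
  minimal (x ∷ X) (y ∷ Y) p eX = ⊥-elim (h (x ∷ X , y ∷ Y , p , (λ ()) , (λ ()) , eX))

circuit? : ∀ es → Dec (Circuit es)
circuit? [] = no λ (ne , _) → ne refl
circuit? es@(_ ∷ _) with even? es | properEvenSplit? es
... | no ¬ev | _      = no λ (_ , ev , _) → ¬ev ev
... | yes _  | yes (X , Y , p , neX , neY , eX) = no λ (_ , _ , mn) → [ neX , neY ]′ (mn X Y p eX)
... | yes ev | no ¬sp = yes (indecomposable⇒circuit (λ ()) ev ¬sp)

decomposes? : ∀ k es → Dec (Decomposes es k)
decomposes? zero [] = yes ([] , refl , [] , ↭-refl)
decomposes? zero (_ ∷ _) = no λ { ([] , _ , _ , p) → ¬x∷xs↭[] p }
decomposes? (suc k) es = map′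
  (λ { (X , Y , p , cX , (L , l , cs , q)) → X ∷ L , cong suc l , cX ∷ cs , trans p (++⁺ˡ X q) })
  (λ { (X ∷ L , l , cX ∷ cs , p) → X , concat L , p , cX , (L , ℕ.suc-injective l , cs , ↭-refl) })
  (anySplit? (λ X Y → circuit? X ×-dec decomposes? k Y)
    (λ p q (c , d) → Circuit-↭ p c , Decomposes-↭ q d) es)

circuit-decomposes : ∀ {es} → Circuit es → Decomposes es 1
circuit-decomposes {es} c = es ∷ [] , refl , c ∷ [] , ↭-reflexive (sym (List.++-identityʳ es))

circuit-decomposes-once : ∀ {es k} → Circuit es → Decomposes es k → k ≡ 1
circuit-decomposes-once (ne , _) ([] , _ , _ , p) = ⊥-elim (ne (↭-empty-inv p))
circuit-decomposes-once (_ , _ , mn) (C ∷ L , refl , (neC , evC , _) ∷ cs , p) with mn C (concat L) p evC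
... | inj₁ C≡[] = ⊥-elim (neC C≡[])
... | inj₂ L≡[] = cong (suc ∘ length) (none L cs L≡[])
  where
  none : ∀ L → All Circuit L → concat L ≡ [] → L ≡ []
  none []      _              _ = refl
  none (D ∷ L) ((neD , _) ∷ _) e = ⊥-elim (neD (List.++-conicalˡ D (concat L) e))

decomposes-++ : ∀ {X Y m n} → Decomposes X m → Decomposes Y n → Decomposes (X ++ Y) (m + n)
decomposes-++ (L , refl , cs , p) (M , refl , ds , q) =
  L ++ M , List.length-++ L , All.++⁺ cs ds , trans (++⁺ p q) (↭-reflexive (List.concat-++ L M))

-- Veblen's theorem: an even multiset is empty, a circuit, or the union of two smaller even ones.
-- The bound `n` on the length drives the recursion.
even-decomposes : ∀ n es → length es ≤ n → Even es → ∃[ k ] Decomposes es k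
even-decomposes n [] _ _ = 0 , [] , refl , [] , ↭-refl
even-decomposes (suc n) es@(_ ∷ _) es≤n ev with properEvenSplit? es
... | no ¬sp = 1 , circuit-decomposes (indecomposable⇒circuit (λ ()) ev ¬sp)
... | yes ([] , Y , p , neX , neY , eX) = ⊥-elim (neX refl)
... | yes (_ ∷ _ , [] , p , neX , neY , eX) = ⊥-elim (neY refl)
... | yes (X@(_ ∷ X') , Y@(_ ∷ Y') , p , neX , neY , eX)
  with s≤s X'+Y≤n ← subst (_≤ suc n) (≡-trans (↭-length p) (List.length-++ X)) es≤n
  with k , dX ← even-decomposes n X (ℕ.≤-trans (ℕ.m<m+n (length X') (s≤s z≤n)) X'+Y≤n) eX
     | l , dY ← even-decomposes n Y (ℕ.≤-trans (ℕ.m≤n+m (length Y) (length X')) X'+Y≤n) (Even-++ʳ X (Even-↭ p ev) eX) =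
  k + l , Decomposes-↭ (↭-sym p) (decomposes-++ dX dY)

-- Circuits are nonempty. This bounds the search for a maximum.
decomposes-≤ : ∀ {es k} → Decomposes es k → k ≤ length es
decomposes-≤ {es} (L , refl , cs , p) = subst (length L ≤_) (sym (↭-length p)) (go L cs)
  where
  go : ∀ L → All Circuit L → length L ≤ length (concat L)
  go [] _ = z≤n
  go ([] ∷ L) ((ne , _) ∷ _) = ⊥-elim (ne refl)
  go ((e ∷ C) ∷ L) (_ ∷ cs) = s≤s (ℕ.≤-trans (go L cs)
    (subst (length (concat L) ≤_) (sym (List.length-++ C)) (ℕ.m≤n+m (length (concat L)) (length C))))

least : ∀ {P : ℕ → Set} → (∀ n → Dec (P n)) → ∀ n → P n → ∃[ m ] (P m × (∀ k → P k → m ≤ k))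
least P? zero p = 0 , p , λ _ _ → z≤n
least P? (suc n) p with P? 0
... | yes p₀ = 0 , p₀ , λ _ _ → z≤n
... | no ¬p₀ with m , pm , h ← least (P? ∘ suc) n p = suc m , pm , λ where
  zero    p₀ → contradiction p₀ ¬p₀
  (suc k) pk → s≤s (h k pk)

greatest : ∀ {P : ℕ → Set} → (∀ n → Dec (P n)) → ∀ b → (∀ k → P k → k ≤ b) → ∃ P
         → ∃[ m ] (P m × (∀ k → P k → k ≤ m))
greatest P? b h (n , p) with P? b
... | yes pb = b , pb , h
greatest P? zero h (n , p) | no ¬pb with z≤n ← h n p = contradiction p ¬pb
greatest P? (suc b) h np | no ¬pb =
  greatest P? b (λ k pk → s≤s⁻¹ (ℕ.≤∧≢⇒< (h k pk) λ { refl → ¬pb pk })) np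

-- Cycle graphs: triangles and their gluings

not-even-singleton : ∀ e → src e ≢ tgt e → ¬ Even [ e ]
not-even-singleton e s≢t ev = case ≡-trans (sym (ev (src e)))
  (≡-trans (xor-identityʳ (∂ e (src e))) (cong₂ _xor_ (δ-refl (src e)) (δ-≢ (s≢t ∘ sym)))) of λ ()

-- Of two nonempty parts of three edges one is a single edge, which is not even because it is not a
-- loop.
triangle-circuit : ∀ {es} → length es ≡ 3 → All (λ e → src e ≢ tgt e) es → Even es → Circuit es
triangle-circuit {es} l nl ev = (λ { refl → case l of λ () }) , ev , minimal
  where
  minimal : ∀ X Y → es ↭ X ++ Y → Even X → X ≡ [] ⊎ Y ≡ []
  minimal [] Y p eX = inj₁ refl
  minimal (_ ∷ _) [] p eX = inj₂ refl
  minimal (x ∷ []) (_ ∷ _) p eX with x≢ ∷ _ ← proj₁ (All-⊆ [ x ] p nl) = ⊥-elim (not-even-singleton x x≢ eX)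
  minimal X@(_ ∷ _ ∷ _) (y ∷ []) p eX with y≢ ∷ _ ← proj₂ (All-⊆ X p nl) =
    ⊥-elim (not-even-singleton y y≢ (Even-++ʳ X (Even-↭ p ev) eX))
  minimal X@(_ ∷ _ ∷ X') Y@(_ ∷ _ ∷ Y') p eX = case too-long of λ ()
    where
    too-long : 3 ≡ 4 + (length X' + length Y')
    too-long = ≡-trans (sym l) (≡-trans (↭-length p) (≡-trans (List.length-++ X)
      (cong (2 +_) (≡-trans (ℕ.+-suc (length X') _) (cong suc (ℕ.+-suc (length X') _))))))

-- Off the ends of `p` the remainders `P` and `Q` are disjoint. An even part of their union can thus
-- be odd on `P` only at these two ends, and then it is odd on `Q` at the same ends; minimality of
-- both circuits makes it all or nothing.
glue-circuits : ∀ {p P q Q} → src p ≢ tgt p → (∀ v → ∂ q v ≡ ∂ p v)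
  → (∀ v → v ≢ src p → v ≢ tgt p → All (Avoids v) P ⊎ All (Avoids v) Q)
  → Circuit (p ∷ P) → Circuit (q ∷ Q) → Circuit (P ++ Q)
glue-circuits {p} {P} {q} {Q} s≢t ∂q P-Q-apart cP@(_ , evP , mnP) cQ@(_ , evQ , mnQ) = nonempty P evP , even , minimal
  where
  nonempty : ∀ P → Even (p ∷ P) → P ++ Q ≢ []
  nonempty [] ev _ = not-even-singleton p s≢t ev
  even : Even (P ++ Q)
  even v = ≡-trans (par-++ v P Q) (≡-trans
    (cong₂ _xor_ (sym (xor≡false {∂ p v} (evP v))) (≡-trans (sym (xor≡false {∂ q v} (evQ v))) (∂q v))) (xor-same (∂ p v)))
  minimal : ∀ X Y → P ++ Q ↭ X ++ Y → Even X → X ≡ [] ⊎ Y ≡ []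
  minimal X Y pm eX with refinement {X₁} {Y₁} {X₂} {Y₂} P↭ Q↭ X↭ Y↭ ← refine P X pm = cases (par (src p) X₁) refl
    where
    X₁≡X₂ : ∀ v → par v X₁ ≡ par v X₂
    X₁≡X₂ v = xor≡false (≡-trans (sym (par-++ v X₁ X₂)) (Even-↭ X↭ eX v))
    outside : ∀ v → v ≢ src p → v ≢ tgt p → par v X₁ ≡ false
    outside v v≢s v≢t with P-Q-apart v v≢s v≢t
    ... | inj₁ h = par-avoid (proj₁ (All-⊆ X₁ P↭ h))
    ... | inj₂ h = ≡-trans (X₁≡X₂ v) (par-avoid (proj₁ (All-⊆ X₂ Q↭ h)))
    -- X meets P either in an even multiset or in one that p completes to an even multiset.
    cases : ∀ β → par (src p) X₁ ≡ β → X ≡ [] ⊎ Y ≡ []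
    cases false eq = inj₁ (++-conical X₁ X↭ (circuit-acyclic cP ↭-refl X₁ Y₁ P↭ eX₁)
      (circuit-acyclic cQ ↭-refl X₂ Y₂ Q↭ (Even-++ʳ X₁ (Even-↭ X↭ eX) eX₁)))
      where
      eX₁ : Even X₁
      eX₁ = Even-except-one (tgt p) X₁ λ v v≢t → case v ≟ src p of λ where
        (yes refl) → eq
        (no v≢s)   → outside v v≢s v≢t
    cases true eq with mnP (p ∷ X₁) Y₁ (prep p P↭) epX₁ | mnQ (q ∷ X₂) Y₂ (prep q Q↭) eqX₂
      where
      epX₁ : Even (p ∷ X₁)
      epX₁ = Even-except-one (tgt p) (p ∷ X₁) λ v v≢t → case v ≟ src p of λ where
        (yes refl) → cong₂ _xor_ (cong₂ _xor_ (δ-refl v) (δ-≢ (v≢t ∘ sym))) eq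
        (no v≢s)   → cong₂ _xor_ (cong₂ _xor_ (δ-≢ (v≢s ∘ sym)) (δ-≢ (v≢t ∘ sym))) (outside v v≢s v≢t)
      eqX₂ : Even (q ∷ X₂)
      eqX₂ v = ≡-trans (cong₂ _xor_ (∂q v) (sym (X₁≡X₂ v))) (epX₁ v)
    ... | inj₂ Y₁≡[] | inj₂ Y₂≡[] = inj₂ (++-conical Y₁ Y↭ Y₁≡[] Y₂≡[])

-- Renaming of vertices and gluing of cycle graphs

EndsIn : List ℕ → Edge → Set
EndsIn V e = src e ∈ V × tgt e ∈ V

EndsIn⇒Avoids : ∀ {V v es} → v ∉ V → All (EndsIn V) es → All (Avoids v) es
EndsIn⇒Avoids v∉V = All.map λ (s , t) → (λ { refl → v∉V s }) , (λ { refl → v∉V t })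

-- `ρ` is injective on `V` only, so parities are compared at the names `ρ v` with `v` in `V`;
-- renamed edges touch no other name.
module Rename (ρ : ℕ → ℕ) (V : List ℕ) (ρ-inj : ∀ x y → x ∈ V → y ∈ V → ρ x ≡ ρ y → x ≡ y) where

  par-rename : ∀ {v es} → v ∈ V → All (EndsIn V) es → par (ρ v) (map (renameE ρ) es) ≡ par v es
  par-rename v∈V [] = refl
  par-rename {v} v∈V ((s , t) ∷ es) = cong₂ _xor_ (cong₂ _xor_ (δ-rename s) (δ-rename t)) (par-rename v∈V es)
    where
    δ-rename : ∀ {x} → x ∈ V → δ (ρ x) (ρ v) ≡ δ x v
    δ-rename {x} x∈V with x ≟ v
    ... | yes refl = ≡-trans (δ-refl (ρ x)) (sym (δ-refl x))
    ... | no x≢v = ≡-trans (δ-≢ (x≢v ∘ ρ-inj x v x∈V v∈V)) (sym (δ-≢ x≢v))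

  Even-rename⁺ : ∀ {es} → All (EndsIn V) es → Even es → Even (map (renameE ρ) es)
  Even-rename⁺ {es} V⊇ ev w with w ∈ℕ? map ρ V
  ... | yes w∈ with v , v∈V , refl ← ∈-map⁻ ρ w∈ = ≡-trans (par-rename v∈V V⊇) (ev v)
  ... | no w∉ = par-avoid (EndsIn⇒Avoids w∉ (All.map⁺ (All.map (λ (s , t) → ∈-map⁺ ρ s , ∈-map⁺ ρ t) V⊇)))

  Even-rename⁻ : ∀ {es} → All (EndsIn V) es → Even (map (renameE ρ) es) → Even es
  Even-rename⁻ V⊇ ev v with v ∈ℕ? V
  ... | yes v∈V = ≡-trans (sym (par-rename v∈V V⊇)) (ev (ρ v))
  ... | no v∉V = par-avoid (EndsIn⇒Avoids v∉V V⊇)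

  circuit-rename : ∀ {C} → All (EndsIn V) C → Circuit C → Circuit (map (renameE ρ) C)
  circuit-rename {C} V⊇ (ne , ev , mn) = nonempty ne , Even-rename⁺ V⊇ ev , minimal
    where
    nonempty : ∀ {C} → C ≢ [] → map (renameE ρ) C ≢ []
    nonempty {[]}    ne = ne
    nonempty {_ ∷ _} ne = λ ()
    minimal : ∀ X Y → map (renameE ρ) C ↭ X ++ Y → Even X → X ≡ [] ⊎ Y ≡ []
    minimal X Y p eX with Z , X++Y≡ , q ← ↭-map-inv (renameE ρ) p
      with X' , Y' , refl , refl , refl ← map-++⁻ (renameE ρ) Z X (sym X++Y≡)
      with mn X' Y' q (Even-rename⁻ (proj₁ (All-⊆ X' q V⊇)) eX)
    ... | inj₁ refl = inj₁ refl
    ... | inj₂ refl = inj₂ refl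

Edges-WF : Graph → Set
Edges-WF G = All (λ e → src e ∈ verts G × tgt e ∈ verts G × src e ≢ tgt e) (edges G)

WF⇒EndsIn : ∀ {G} → Edges-WF G → All (EndsIn (verts G)) (edges G)
WF⇒EndsIn = All.map λ (s , t , _) → s , t

CycleGraph : Graph → Set
CycleGraph G = Edges-WF G × Circuit (edges G)

glue-cycleGraphs : ∀ {P Q R} → CycleGraph P → CycleGraph Q → Glue P Q R → CycleGraph R
glue-cycleGraphs {P} {Q} (wfP , cP) (wfQ , cQ) (i , j , _ , ρ , _ , _ , ρs , ρt , ρ-inj , ρ-new , refl) =
  All.++⁺ (All.map (λ (s , t , s≢t) → ∈-++⁺ˡ s , ∈-++⁺ˡ t , s≢t) wfP')
          (All.map⁺ (All.map (λ {e} (s , t , s≢t) → ρ-in s , ρ-in t , s≢t ∘ ρ-inj (src e) (tgt e) s t) wfQ'))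
  , glue-circuits (proj₂ (proj₂ wf-p)) ∂q glued-apart (Circuit-↭ P↭ cP)
      (Rename.circuit-rename ρ (verts Q) ρ-inj
        (WF⇒EndsIn {graph (verts Q) (q ∷ Q')} (All-resp-↭ Q↭ wfQ)) (Circuit-↭ Q↭ cQ))
  where
  p = edgeOf P i
  q = edgeOf Q j
  P' = removeAt (edges P) i
  Q' = removeAt (edges Q) j
  P↭ = lookup-removeAt (edges P) i
  Q↭ = lookup-removeAt (edges Q) j
  wf-p = All.head (All-resp-↭ P↭ wfP)
  wfP' = All.tail (All-resp-↭ P↭ wfP)
  wfQ' = All.tail (All-resp-↭ Q↭ wfQ)
  keep? = λ x → ¬? (x ≟ src q) ×-dec ¬? (x ≟ tgt q)

  ρ-in : ∀ {x} → x ∈ verts Q → ρ x ∈ verts P ++ map ρ (filter keep? (verts Q))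
  ρ-in {x} x∈ with x ≟ src q | x ≟ tgt q
  ... | yes refl | _ = ∈-++⁺ˡ (subst (_∈ verts P) (sym ρs) (proj₁ wf-p))
  ... | no _ | yes refl = ∈-++⁺ˡ (subst (_∈ verts P) (sym ρt) (proj₁ (proj₂ wf-p)))
  ... | no x≢s | no x≢t = ∈-++⁺ʳ (verts P) (∈-map⁺ ρ (∈-filter⁺ keep? x∈ (x≢s , x≢t)))

  ∂q : ∀ v → ∂ (renameE ρ q) v ≡ ∂ p v
  ∂q v = cong₂ (λ x y → δ x v xor δ y v) ρs ρt

  -- A vertex of `P` other than the ends of `p` is missed by `ρ`, which sends the ends of `q` to
  -- those of `p` and all other vertices of `Q` outside `P`.
  glued-apart : ∀ v → v ≢ src p → v ≢ tgt p → All (Avoids v) P' ⊎ All (Avoids v) (map (renameE ρ) Q')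
  glued-apart v v≢s v≢t with v ∈ℕ? verts P
  ... | no v∉ = inj₁ (EndsIn⇒Avoids v∉ (WF⇒EndsIn {graph (verts P) P'} wfP'))
  ... | yes v∈ = inj₂ (All.map⁺ (All.map (λ (s , t , _) → misses s , misses t) wfQ'))
    where
    misses : ∀ {x} → x ∈ verts Q → ρ x ≢ v
    misses {x} x∈ refl with x ≟ src q | x ≟ tgt q
    ... | yes refl | _ = v≢s ρs
    ... | no _ | yes refl = v≢t ρt
    ... | no x≢s | no x≢t = ρ-new x x∈ x≢s x≢t v∈

-- Cycle decompositions as decompositions of the edge multiset into circuits

module Cycles (G : Graph) where

  -- Unlike `Linked`, this admits the empty walk. Each entry carries the vertex that its edge
  -- leaves, so the final `z` has no entry of its own.
  data Walk : ℕ → List (Ed G × ℕ) → ℕ → Set where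
    []  : ∀ {x} → Walk x [] x
    _∷_ : ∀ {x y z e ws} → Joins G e x y → Walk y ws z → Walk x ((e , x) ∷ ws) z

  visited : List (Ed G × ℕ) → List ℕ
  visited = map proj₂

  used : List (Ed G × ℕ) → List (Ed G)
  used = map proj₁

  edgesAt : List (Ed G) → List Edge
  edgesAt = map (edgeOf G)

  linked⇒walk : ∀ {first e v} ws → Linked G first ((e , v) ∷ ws) → Walk v ((e , v) ∷ ws) first
  linked⇒walk []       j       = j ∷ []
  linked⇒walk (_ ∷ ws) (j , l) = j ∷ linked⇒walk ws l

  walk⇒linked : ∀ {x e z} ws → Walk x ((e , x) ∷ ws) z → Linked G z ((e , x) ∷ ws)
  walk⇒linked []       (j ∷ [])           = j
  walk⇒linked (_ ∷ ws) (j ∷ w@(_ ∷ _)) = j , walk⇒linked ws w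

  ∂-joins : ∀ {e x y} → Joins G e x y → ∀ v → ∂ (edgeOf G e) v ≡ δ x v xor δ y v
  ∂-joins (inj₁ (refl , refl)) v = refl
  ∂-joins {e} (inj₂ (refl , refl)) v = xor-comm (δ (src (edgeOf G e)) v) (δ (tgt (edgeOf G e)) v)

  walk-par : ∀ {x ws z} → Walk x ws z → ∀ v → par v (edgesAt (used ws)) ≡ δ x v xor δ z v
  walk-par {x} [] v = sym (xor-same (δ x v))
  walk-par {x} {z = z} (_∷_ {y = y} {e = e} {ws = ws} j w) v = begin
    ∂ (edgeOf G e) v xor par v (edgesAt (used ws))  ≡⟨ cong₂ _xor_ (∂-joins j v) (walk-par w v) ⟩
    (δ x v xor δ y v) xor (δ y v xor δ z v)         ≡⟨ xor-assoc (δ x v) (δ y v) _ ⟩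
    δ x v xor (δ y v xor (δ y v xor δ z v))         ≡⟨ cong (δ x v xor_) (sym (xor-assoc (δ y v) (δ y v) (δ z v))) ⟩
    δ x v xor ((δ y v xor δ y v) xor δ z v)         ≡⟨ cong (λ b → δ x v xor (b xor δ z v)) (xor-same (δ y v)) ⟩
    δ x v xor δ z v                                 ∎
    where open ≡-Reasoning

  walk-source : ∀ {x ws z} → Walk x ws z → x ∈ visited ws ⊎ x ≡ z
  walk-source []      = inj₂ refl
  walk-source (_ ∷ _) = inj₁ (here refl)

  walk-avoids : ∀ {x ws z v} → Walk x ws z → v ∉ visited ws → v ≢ z → All (Avoids v) (edgesAt (used ws))
  walk-avoids [] _ _ = []
  walk-avoids {x} {_ ∷ ws} {z} {v} (_∷_ {y = y} {e = e} j w) v∉ v≢z = avoids j ∷ walk-avoids w (v∉ ∘ there) v≢z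
    where
    x≢v : x ≢ v
    x≢v refl = v∉ (here refl)
    y≢v : y ≢ v
    y≢v refl = case walk-source w of λ where
      (inj₁ y∈)   → v∉ (there y∈)
      (inj₂ refl) → v≢z refl
    avoids : Joins G e x y → Avoids v (edgeOf G e)
    avoids (inj₁ (refl , refl)) = x≢v , y≢v
    avoids (inj₂ (refl , refl)) = y≢v , x≢v

  OneSided : Bool → List Edge → List Edge → Set
  OneSided true  X Y = Y ≡ []
  OneSided false X Y = X ≡ []

  -- Each visited vertex meets exactly two consecutive edges of the walk, so the side of
  -- an edge propagates to the next one; β is the side of the edge preceding the walk.
  path-one-sided : ∀ {x ws z} β X Y → Walk x ws z → Unique (visited ws) → z ∉ visited ws
    → edgesAt (used ws) ↭ X ++ Y → (∀ v → v ∈ visited ws → par v X ≡ δ x v ∧ β) → OneSided β X Y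
  path-one-sided true  X Y [] _ _ p _ = List.++-conicalʳ X Y (↭-empty-inv (↭-sym p))
  path-one-sided false X Y [] _ _ p _ = List.++-conicalˡ X Y (↭-empty-inv (↭-sym p))
  path-one-sided {x} {_ ∷ ws} {z} β X Y (_∷_ {y = y} {e = e} j w) (x∉ ∷ u) z∉ p h = go (∷-split X p)
    where
    off : All (Avoids x) (edgesAt (used ws))
    off = walk-avoids w (All.All¬⇒¬Any x∉) λ { refl → z∉ (here refl) }
    y≢x : y ≢ x
    y≢x refl = case walk-source w of λ where
      (inj₁ y∈)   → All.All¬⇒¬Any x∉ y∈
      (inj₂ refl) → z∉ (here refl)
    x≢ : ∀ {v} → v ∈ visited ws → x ≢ v
    x≢ = All.lookup x∉
    h-x : par x X ≡ β
    h-x = ≡-trans (h x (here refl)) (cong (_∧ β) (δ-refl x))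
    h-rest : ∀ v → v ∈ visited ws → par v X ≡ false
    h-rest v v∈ = ≡-trans (h v (there v∈)) (cong (_∧ β) (δ-≢ (x≢ v∈)))
    go : _ → OneSided β X Y
    go (inj₁ (X' , q , r)) = subst (λ β → OneSided β X Y) (≡-trans (sym X-odd) h-x)
        (path-one-sided true X' Y w u (z∉ ∘ there) r X'-par)
      where
      X-odd : par x X ≡ true
      X-odd = ≡-trans (par-↭ x q) (cong₂ _xor_
        (≡-trans (∂-joins j x) (cong₂ _xor_ (δ-refl x) (δ-≢ y≢x))) (par-avoid (proj₁ (All-⊆ X' r off))))
      X'-par : ∀ v → v ∈ visited ws → par v X' ≡ δ y v ∧ true
      X'-par v v∈ = begin
        par v X'           ≡⟨ sym (xor≡false (≡-trans (sym (par-↭ v q)) (h-rest v v∈))) ⟩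
        ∂ (edgeOf G e) v   ≡⟨ ∂-joins j v ⟩
        δ x v xor δ y v    ≡⟨ cong (_xor δ y v) (δ-≢ (x≢ v∈)) ⟩
        δ y v              ≡⟨ sym (Bool.∧-identityʳ (δ y v)) ⟩
        δ y v ∧ true       ∎
        where open ≡-Reasoning
    go (inj₂ (Y' , q , r)) = subst (λ β → OneSided β X Y) (≡-trans (sym X-even) h-x)
        (path-one-sided false X Y' w u (z∉ ∘ there) r
          λ v v∈ → ≡-trans (h-rest v v∈) (sym (Bool.∧-zeroʳ (δ y v))))
      where
      X-even : par x X ≡ false
      X-even = par-avoid (proj₁ (All-⊆ X r off))

  -- Without its first edge a cycle is a path, and the part containing that edge provides the
  -- initial `β` of `path-one-sided`.
  cycle-circuit : (C : Cycle G) → Circuit (edgesAt (cycEdges C))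
  cycle-circuit C = go (walk C) (closed C) (uniqV C)
    where
    go : ∀ ws → Closed G ws → Unique (visited ws) → Circuit (edgesAt (used ws))
    go ((e , x) ∷ ws) cl (x∉ ∷ u) with _∷_ {y = y} j w ← linked⇒walk ws cl = (λ ()) , even , minimal
      where
      even : Even (edgesAt (used ((e , x) ∷ ws)))
      even v = ≡-trans (walk-par (j ∷ w) v) (xor-same (δ x v))
      minimal : ∀ X Y → edgesAt (used ((e , x) ∷ ws)) ↭ X ++ Y → Even X → X ≡ [] ⊎ Y ≡ []
      minimal X Y p eX with ∷-split X p
      ... | inj₂ (Y' , q , r) = inj₁ (path-one-sided false X Y' w u (All.All¬⇒¬Any x∉) r
              λ v v∈ → ≡-trans (eX v) (sym (Bool.∧-zeroʳ _)))
      ... | inj₁ (X' , q , r) = inj₂ (path-one-sided true X' Y w u (All.All¬⇒¬Any x∉) r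
              λ v v∈ → ≡-trans (sym (xor≡false (Even-↭ q eX v))) (≡-trans (∂-joins j v)
                (≡-trans (cong (_xor δ y v) (δ-≢ (All.lookup x∉ v∈))) (sym (Bool.∧-identityʳ _)))))

  -- The stretch up to `y` is what a further edge from `y` to `x` closes into a cycle. The end `z`
  -- is a possible `y` as well, hence the `[ z ]`.
  cut : ∀ {x ws z y} → Walk x ws z → Unique (visited ws ++ [ z ]) → y ∈ visited ws ++ [ z ]
      → ∃₂ λ ws₁ ws₂ → ws ≡ ws₁ ++ ws₂ × Walk x ws₁ y × Unique (y ∷ visited ws₁)
  cut [] _ (here refl) = [] , [] , refl , [] , [] ∷ []
  cut (j ∷ w) _ (here refl) = [] , _ , refl , [] , [] ∷ []
  cut {x} {z = z} (j ∷ w) (x∉ ∷ u) (there y∈) with ws₁ , ws₂ , refl , w₁ , y∉ ∷ u₁ ← cut w u y∈ =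
    _ ∷ ws₁ , ws₂ , refl , j ∷ w₁ , ((All.lookup x∉ y∈ ∘ sym) ∷ y∉) ∷ (x∉₁ ∷ u₁)
    where
    x∉₁ : All (x ≢_) (visited ws₁)
    x∉₁ = All.++⁻ˡ (visited ws₁) (subst (All (x ≢_)) (List.map-++ proj₂ ws₁ ws₂) (All.++⁻ˡ (visited (ws₁ ++ ws₂)) x∉))

  odd-edge : ∀ v es → par v (edgesAt es) ≡ true → ∃[ e ] (e ∈ es × ∂ (edgeOf G e) v ≡ true)
  odd-edge v (e ∷ es) h with ∂ (edgeOf G e) v in eq
  ... | true = e , here refl , eq
  ... | false with e' , e'∈ , eq' ← odd-edge v es h = e' , there e'∈ , eq'

  Loopless : Set
  Loopless = ∀ e → src (edgeOf G e) ≢ tgt (edgeOf G e)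

  module _ (nl : Loopless) where

    other-end : ∀ e x → ∂ (edgeOf G e) x ≡ true → ∃[ y ] (Joins G e y x × y ≢ x)
    other-end e x h with src (edgeOf G e) ≟ x | tgt (edgeOf G e) ≟ x
    ... | yes refl | _        = tgt (edgeOf G e) , inj₂ (refl , refl) , nl e ∘ sym
    ... | no s≢x   | yes refl = src (edgeOf G e) , inj₁ (refl , refl) , s≢x
    ... | no s≢x   | no t≢x   = case ≡-trans (sym h) (Avoids⇒∂ (edgeOf G e) (s≢x , t≢x)) of λ ()

    module _ (js : List (Ed G)) (unique : Unique js) (circuit : Circuit (edgesAt js)) where

      -- The cycle obtained is a nonempty even part of the circuit, so by minimality no edge is left
      -- over.
      close : ∀ {x y e ws₁ rest} → Joins G e y x → y ≢ x → Walk x ws₁ y → Unique (y ∷ visited ws₁)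
            → js ↭ (e ∷ used ws₁) ++ rest → Σ (Cycle G) λ C → js ↭ cycEdges C
      close j y≢x [] _ _ = ⊥-elim (y≢x refl)
      close {y = y} {e} {ws₁} {rest} j y≢x w@(_ ∷ _) u p = C , js↭
        where
        C : Cycle G
        C = record
          { walk   = (e , y) ∷ ws₁
          ; long   = s≤s (s≤s z≤n)
          ; uniqV  = u
          ; uniqE  = Unique-++⁻ˡ (e ∷ used ws₁) (Unique-resp-↭ p unique)
          ; closed = walk⇒linked ws₁ (j ∷ w)
          }
        p' : edgesAt js ↭ edgesAt (cycEdges C) ++ edgesAt rest
        p' = trans (map⁺ (edgeOf G) p) (↭-reflexive (List.map-++ (edgeOf G) (cycEdges C) rest))
        rest≡[] : ∀ rest → edgesAt rest ≡ [] → rest ≡ []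
        rest≡[] [] _ = refl
        js↭ : js ↭ cycEdges C
        js↭ with proj₂ (proj₂ circuit) _ (edgesAt rest) p' (proj₁ (proj₂ (cycle-circuit C)))
        ... | inj₂ r≡[] = trans p (↭-reflexive
                (≡-trans (cong (cycEdges C ++_) (rest≡[] rest r≡[])) (List.++-identityʳ (cycEdges C))))

      rest-odd : ∀ {x e ws z rest} → Walk x ((e , x) ∷ ws) z → All (x ≢_) (visited ws ++ [ z ])
               → js ↭ used ((e , x) ∷ ws) ++ rest → par x (edgesAt rest) ≡ true
      rest-odd {x} {e} {ws'} {z} {rest} w x∉ p = begin
        par x (edgesAt rest)        ≡⟨ sym (xor≡false even-total) ⟩
        par x (edgesAt (used ws))   ≡⟨ walk-par w x ⟩
        δ x x xor δ z x             ≡⟨ cong₂ _xor_ (δ-refl x) (δ-≢ z≢x) ⟩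
        true                        ∎
        where
        open ≡-Reasoning
        ws = (e , x) ∷ ws'
        z≢x : z ≢ x
        z≢x = All.lookup x∉ (∈-++⁺ʳ (visited ws') (here refl)) ∘ sym
        even-total : par x (edgesAt (used ws)) xor par x (edgesAt rest) ≡ false
        even-total = ≡-trans (sym (par-++ x (edgesAt (used ws)) (edgesAt rest)))
          (≡-trans (cong (par x) (sym (List.map-++ (edgeOf G) (used ws) rest)))
            (Even-↭ (map⁺ (edgeOf G) p) (proj₁ (proj₂ circuit)) x))

      -- The unused edges have odd parity at the front of the path, so it can be extended.
      grow : ∀ n {x e ws z rest} → length rest ≤ n → Walk x ((e , x) ∷ ws) z
           → Unique (x ∷ visited ws ++ [ z ]) → js ↭ used ((e , x) ∷ ws) ++ rest
           → Σ (Cycle G) λ C → js ↭ cycEdges C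
      grow n {x} {e} {ws'} {z} {rest} rest≤n w u@(x∉ ∷ _) p
        with f , f∈ , ∂f ← odd-edge x rest (rest-odd w x∉ p)
        with rest' , q ← ∈⇒↭ f∈ | y , j , y≢x ← other-end f x ∂f =
        continue n (subst (_≤ n) (↭-length q) rest≤n) (y ∈ℕ? visited ws ++ [ z ])
        where
        ws = (e , x) ∷ ws'
        continue : ∀ n → suc (length rest') ≤ n → Dec (y ∈ visited ws ++ [ z ]) → Σ (Cycle G) λ C → js ↭ cycEdges C
        continue (suc n) (s≤s rest'≤n) (no y∉) = grow n rest'≤n (j ∷ w) (All.¬Any⇒All¬ _ y∉ ∷ u)
          (trans p (trans (++⁺ˡ (used ws) q) (shift f (used ws) rest')))
        -- The new edge returns to the path and closes the stretch `ws₁`; the tail `ws₂` counts as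
        -- left over, together with `rest'`.
        continue _ _ (yes y∈) with ws₁ , ws₂ , eq , w₁ , u₁ ← cut w u y∈ =
         close {rest = used ws₂ ++ rest'} j y≢x w₁ u₁ (begin
          js                                        ↭⟨ p ⟩
          used ws ++ rest                           ≡⟨ cong (λ ws → used ws ++ rest) eq ⟩
          used (ws₁ ++ ws₂) ++ rest                 ↭⟨ ++⁺ (↭-reflexive (List.map-++ proj₁ ws₁ ws₂)) q ⟩
          (used ws₁ ++ used ws₂) ++ (f ∷ rest')     ↭⟨ regroup (used ws₁) (used ws₂) [ f ] rest' ⟩
          (f ∷ used ws₁) ++ (used ws₂ ++ rest')     ∎)
          where
          open PermutationReasoning
          regroup : ∀ (xs ys zs ws : List (Ed G)) → (xs ++ ys) ++ (zs ++ ws) ↭ (zs ++ xs) ++ (ys ++ ws)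
          regroup = solve 4 (λ xs ys zs ws → (xs ⊕ ys) ⊕ (zs ⊕ ws) ⊜ (zs ⊕ xs) ⊕ (ys ⊕ ws)) ↭-refl
            where open import Algebra.Solver.CommutativeMonoid (++-commutativeMonoid {A = Ed G})

    circuit-cycle : ∀ js → Unique js → Circuit (edgesAt js) → Σ (Cycle G) λ C → js ↭ cycEdges C
    circuit-cycle [] _ (ne , _) = ⊥-elim (ne refl)
    circuit-cycle (e ∷ js) u c = grow (e ∷ js) u c (length js) {rest = js} ℕ.≤-refl
      (inj₁ (refl , refl) ∷ []) ((nl e ∷ []) ∷ [] ∷ []) ↭-refl

  -- Cycle decompositions as permutations of the edge positions

  open DecMem (F._≟_ {length (edges G)}) using (_∈?_)

  cover : List (Cycle G) → List (Ed G)
  cover D = concat (map cycEdges D)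

  occurrences : Ed G → List (Cycle G) → ℕ
  occurrences e D = length (filter (λ C → e ∈? cycEdges C) D)

  covered⇒occurs : ∀ e D → e ∈ cover D → 1 ≤ occurrences e D
  covered⇒occurs e (C ∷ D) e∈ with e ∈? cycEdges C
  ... | yes _ = s≤s z≤n
  ... | no e∉ with ∈-++⁻ (cycEdges C) e∈
  ...   | inj₁ e∈C = contradiction e∈C e∉
  ...   | inj₂ e∈D = covered⇒occurs e D e∈D

  occurs⇒covered : ∀ e D → 1 ≤ occurrences e D → e ∈ cover D
  occurs⇒covered e (C ∷ D) h with e ∈? cycEdges C
  ... | yes e∈C = ∈-++⁺ˡ e∈C
  ... | no _    = ∈-++⁺ʳ (cycEdges C) (occurs⇒covered e D h)

  unique-cover⁺ : ∀ D → (∀ e → occurrences e D ≤ 1) → Unique (cover D)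
  unique-cover⁺ [] _ = []
  unique-cover⁺ (C ∷ D) h = Unique.++⁺ (uniqE C) (unique-cover⁺ D λ e → ℕ.≤-trans (tail≤ e) (h e)) disjoint
    where
    tail≤ : ∀ e → occurrences e D ≤ occurrences e (C ∷ D)
    tail≤ e with e ∈? cycEdges C
    ... | yes _ = ℕ.n≤1+n _
    ... | no _  = ℕ.≤-refl
    disjoint : ∀ {e} → ¬ (e ∈ cycEdges C × e ∈ cover D)
    disjoint {e} (e∈C , e∈D) with e ∈? cycEdges C | h e
    ... | yes _  | s≤s h' = case ℕ.≤-trans (covered⇒occurs e D e∈D) h' of λ ()
    ... | no e∉C | _      = e∉C e∈C

  unique-cover⁻ : ∀ D → Unique (cover D) → ∀ e → occurrences e D ≤ 1
  unique-cover⁻ [] _ _ = z≤n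
  unique-cover⁻ (C ∷ D) u e with e ∈? cycEdges C
  ... | no _ = unique-cover⁻ D (Unique-++⁻ʳ (cycEdges C) u) e
  ... | yes e∈C with ℕ.≤-<-connex 1 (occurrences e D)
  ...   | inj₁ 1≤ = ⊥-elim (Unique-++⁻-disjoint (cycEdges C) u e∈C (occurs⇒covered e D 1≤))
  ...   | inj₂ (s≤s ≤0) = s≤s ≤0

  edgesAt-all : edgesAt (allFin (length (edges G))) ≡ edges G
  edgesAt-all = ≡-trans (List.map-tabulate id (edgeOf G)) (List.tabulate-lookup (edges G))

  cycles⇒circuits : ∀ D → IsCycleDecomposition G D → Decomposes (edges G) (length D)
  cycles⇒circuits D isD =
      map edgesAt (map cycEdges D)
    , ≡-trans (List.length-map _ (map cycEdges D)) (List.length-map _ D)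
    , All.map⁺ (All.map⁺ (All.universal cycle-circuit D))
    , (begin
        edges G                                ≡⟨ sym edgesAt-all ⟩
        edgesAt (allFin (length (edges G)))    ↭⟨ map⁺ (edgeOf G) (same-members⇒↭ (Unique.allFin⁺ _)
                                                    (unique-cover⁺ D (ℕ.≤-reflexive ∘ isD))
                                                    (λ e _ → occurs⇒covered e D (ℕ.≤-reflexive (sym (isD e))))
                                                    (λ e _ → ∈-allFin e)) ⟩
        edgesAt (cover D)                      ≡⟨ sym (List.concat-map (map cycEdges D)) ⟩
        concat (map edgesAt (map cycEdges D))  ∎)
    where open PermutationReasoning

  circuit-cycles : Loopless → ∀ J → All Circuit (map edgesAt J) → Unique (concat J)
         → ∃[ D ] (length D ≡ length J × concat J ↭ cover D)
  circuit-cycles _  []      _        _ = [] , refl , ↭-refl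
  circuit-cycles nl (j ∷ J) (c ∷ cs) u
    with C , j↭C ← circuit-cycle nl j (Unique-++⁻ˡ j u) c | D , l , p ← circuit-cycles nl J cs (Unique-++⁻ʳ j u) =
    C ∷ D , cong suc l , ++⁺ j↭C p

  circuits⇒cycles : Loopless → ∀ {k} → Decomposes (edges G) k
                  → ∃[ D ] (IsCycleDecomposition G D × length D ≡ k)
  circuits⇒cycles nl (L , refl , cs , p)
    -- `Decomposes` cannot tell equal edges at different positions apart; lifting the permutation
    -- along `edgeOf` assigns them distinct positions again.
    with js , L≡js , q ← ↭-map-inv (edgeOf G) (trans (↭-reflexive edgesAt-all) p)
    with J , refl , refl ← concat-map⁻ (edgeOf G) L js L≡js
    with D , l , r ← circuit-cycles nl J cs (Unique-resp-↭ q (Unique.allFin⁺ _))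
    = D , (λ e → ℕ.≤-antisym (unique-cover⁻ D (Unique-resp-↭ (trans q r) (Unique.allFin⁺ _)) e)
                   (covered⇒occurs e D (∈-resp-↭ (trans q r) (∈-allFin e))))
        , ≡-trans l (sym (List.length-map edgesAt J))

-- A 2.5-split as a decomposition of the edge multiset

record TwoSum (P H₁ H₂ : Graph) : Set where
  field
    {a b c} : ℕ
    {e f}   : Edge
    {E₁ E₂} : List Edge
    a≢b : a ≢ b
    a≢c : a ≢ c
    ∂e  : ∀ v → ∂ e v ≡ δ a v xor δ b v
    ∂f  : ∀ v → ∂ f v ≡ δ a v xor δ c v
    separated : Separated a b c E₁ E₂
    P↭  : edges P ↭ e ∷ E₁ ++ E₂
    H₁↭ : edges H₁ ↭ f ∷ E₁
    H₂↭ : edges H₂ ↭ f ∷ e ∷ E₂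
    wf₁ : Edges-WF H₁
    wf₂ : Edges-WF H₂

module _ {P H₁ H₂ : Graph} (ts : TwoSum P H₁ H₂) where
  open TwoSum ts

  twoSum-split : ∀ {k} → Decomposes (edges P) k
    → ∃₂ λ m n → k ≡ suc (m + n) × Decomposes (edges H₁) (suc m) × Decomposes (edges H₂) (suc n)
  twoSum-split d with m , n , eq , d₁ , d₂ ← Split.split a≢b a≢c ∂e ∂f separated (Decomposes-↭ P↭ d) =
    m , n , eq , Decomposes-↭ (↭-sym H₁↭) d₁ , Decomposes-↭ (↭-sym H₂↭) d₂

  twoSum-join : ∀ {k₁ k₂} → Decomposes (edges H₁) k₁ → Decomposes (edges H₂) k₂
    → ∃₂ λ m n → k₁ ≡ suc m × k₂ ≡ suc n × Decomposes (edges P) (suc (m + n))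
  twoSum-join d₁ d₂
    with m , n , eq₁ , eq₂ , d ← Split.join a≢b a≢c ∂e ∂f separated (Decomposes-↭ H₁↭ d₁) (Decomposes-↭ H₂↭ d₂) =
    m , n , eq₁ , eq₂ , Decomposes-↭ (↭-sym P↭) d

filter-partition : ∀ {A : Set} {P Q : A → Set} (P? : ∀ x → Dec (P x)) (Q? : ∀ x → Dec (Q x)) {xs}
  → All (λ x → (P x × ¬ Q x) ⊎ (Q x × ¬ P x)) xs → xs ↭ filter P? xs ++ filter Q? xs
filter-partition P? Q? [] = ↭-refl
filter-partition P? Q? {x ∷ xs} (inj₁ (p , ¬q) ∷ h)
  rewrite List.filter-accept P? {xs = xs} p | List.filter-reject Q? {xs = xs} ¬q = prep x (filter-partition P? Q? h)
filter-partition P? Q? {x ∷ xs} (inj₂ (q , ¬p) ∷ h)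
  rewrite List.filter-reject P? {xs = xs} ¬p | List.filter-accept Q? {xs = xs} q =
  trans (prep x (filter-partition P? Q? h)) (↭-sym (shift x (filter P? xs) (filter Q? xs)))

-- Paths and the structure at a vertex-edge-separator

module _ {G : Graph} {okV : ℕ → Set} {okE : Ed G → Set} where

  path-source : ∀ {x y} → Path G okV okE x y → okV x
  path-source (here ok)         = ok
  path-source (step ok _ _ _ _) = ok

  path-trans : ∀ {x y z} → Path G okV okE x y → Path G okV okE y z → Path G okV okE x z
  path-trans (here _)          q = q
  path-trans (step ok e k j p) q = step ok e k j (path-trans p q)

  path-sym : ∀ {x y} → Path G okV okE x y → Path G okV okE y x
  path-sym (here ok)         = here ok
  path-sym (step ok e k j p) = path-trans (path-sym p) (step (path-source p) e k (Sum.swap j) (here ok))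

joins-ends : ∀ {G e a b x y} → Joins G e a b → Joins G e x y → (x ≡ a × y ≡ b) ⊎ (x ≡ b × y ≡ a)
joins-ends (inj₁ (refl , refl)) (inj₁ (refl , refl)) = inj₁ (refl , refl)
joins-ends (inj₁ (refl , refl)) (inj₂ (refl , refl)) = inj₂ (refl , refl)
joins-ends (inj₂ (refl , refl)) (inj₁ (refl , refl)) = inj₂ (refl , refl)
joins-ends (inj₂ (refl , refl)) (inj₂ (refl , refl)) = inj₁ (refl , refl)

joins-elim : ∀ {G e a b} → Joins G e a b → (Q : ℕ → Set) → Q a → Q b → Q (src (edgeOf G e)) × Q (tgt (edgeOf G e))
joins-elim (inj₁ (refl , refl)) Q qa qb = qa , qb
joins-elim (inj₂ (refl , refl)) Q qa qb = qb , qa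

joins-members : ∀ {G e a b} → Edges-WF G → Joins G e a b → a ∈ verts G × b ∈ verts G × a ≢ b
joins-members {G} {e} wf j with s , t , s≢t ← All.lookup wf (∈-lookup e) | j
... | inj₁ (refl , refl) = s , t , s≢t
... | inj₂ (refl , refl) = t , s , s≢t ∘ sym

module SplitStructure {P : Graph} (wf : Edges-WF P) (ℓ : ℕ) {c : ℕ} {e : Ed P} (sep : VESeparator P c e)
  {a b : ℕ} (j : Joins P e a b) {A B : List ℕ} (isA : IsComponent P c e a A) (isB : IsComponent P c e b B) where

  Reach : ℕ → ℕ → Set
  Reach = PathAvoid P c e

  biconnected : Biconnected P
  biconnected = proj₁ sep

  c∈ : c ∈ verts P
  c∈ = proj₁ (proj₂ (proj₂ sep))

  ends = joins-members {P} wf j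

  -- Reachability may be proved under the assumption of its negation. That assumption gives `x ≢ y`,
  -- which biconnectedness asks for.
  separating : ¬ (∀ {x y} → x ∈ verts P → y ∈ verts P → x ≢ c → y ≢ c → ¬ Reach x y → Reach x y)
  separating h = let _ , _ , _ , x , y , x∈ , y∈ , x≢c , y≢c , unreachable = sep in
    unreachable (h x∈ y∈ x≢c y≢c unreachable)

  -- If `c` were an end of `e`, a path avoiding `c` would avoid `e` too, and biconnectedness would
  -- leave nothing separated.
  c-not-end : ¬ (a ≡ c ⊎ b ≡ c)
  c-not-end end = separating λ x∈ y∈ x≢c y≢c unreachable →
    avoid (proj₂ biconnected _ _ c x∈ y∈ c∈ (λ { refl → unreachable (here x≢c) }) x≢c y≢c)
    where
    avoid : ∀ {x y} → Path P (_≢ c) (λ _ → ⊤) x y → Reach x y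
    avoid (here ok) = here ok
    avoid (step ok f _ k p) with f F.≟ e
    ... | no f≢e = step ok f f≢e k (avoid p)
    ... | yes refl with joins-ends {P} j k
    ...   | inj₁ (refl , refl) = ⊥-elim ([ ok , path-source p ]′ end)
    ...   | inj₂ (refl , refl) = ⊥-elim ([ path-source p , ok ]′ end)

  a≢c : a ≢ c
  a≢c = c-not-end ∘ inj₁

  b≢c : b ≢ c
  b≢c = c-not-end ∘ inj₂

  -- Whenever the path uses `e` it arrives at `a` or `b`, and the count of what is reached restarts
  -- from there.
  reach-either : ∀ {x z} → Reach a x ⊎ Reach b x → Path P (_≢ c) (λ _ → ⊤) x z → Reach a z ⊎ Reach b z
  reach-either r (here _) = r
  reach-either r (step ok f _ k p) with f F.≟ e
  ... | no f≢e = reach-either (Sum.map extend extend r) p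
    where
    extend : ∀ {w} → Reach w _ → Reach w _
    extend q = path-trans q (step ok f f≢e k (here (path-source p)))
  ... | yes refl with joins-ends {P} j k
  ...   | inj₁ (refl , refl) = reach-either (inj₂ (here b≢c)) p
  ...   | inj₂ (refl , refl) = reach-either (inj₁ (here a≢c)) p

  reachable : ∀ {z} → z ∈ verts P → z ≢ c → Reach a z ⊎ Reach b z
  reachable {z} z∈ z≢c with a ≟ z
  ... | yes refl = inj₁ (here a≢c)
  ... | no a≢z = reach-either (inj₁ (here a≢c)) (proj₂ biconnected a z c (proj₁ ends) z∈ c∈ a≢z a≢c z≢c)

  -- Otherwise every vertex other than `c` would be reachable from `a`, against the choice of the
  -- separator.
  a↛b : ¬ Reach a b
  a↛b r = separating λ x∈ y∈ x≢c y≢c _ → path-trans (path-sym (from-a x∈ x≢c)) (from-a y∈ y≢c)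
    where
    from-a : ∀ {z} → z ∈ verts P → z ≢ c → Reach a z
    from-a z∈ z≢c = [ id , path-trans r ]′ (reachable z∈ z≢c)

  A-reach : ∀ {x} → x ∈ A → Reach a x
  A-reach = proj₁ (proj₂ isA) _

  B-reach : ∀ {x} → x ∈ B → Reach b x
  B-reach = proj₁ (proj₂ isB) _

  disjoint : ∀ {v} → v ≢ c → v ∈ c ∷ A → v ∉ c ∷ B
  disjoint v≢c (here v≡c)  _           = v≢c v≡c
  disjoint v≢c (there v∈A) (here v≡c)  = v≢c v≡c
  disjoint v≢c (there v∈A) (there v∈B) = a↛b (path-trans (A-reach v∈A) (path-sym (B-reach v∈B)))

  a∈A : a ∈ c ∷ A
  a∈A = there (proj₂ (proj₂ isA) a (here a≢c))

  b∈B : b ∈ c ∷ B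
  b∈B = there (proj₂ (proj₂ isB) b (here b≢c))

  a∉B : a ∉ c ∷ B
  a∉B = disjoint a≢c a∈A

  b∉A : b ∉ c ∷ A
  b∉A b∈A = disjoint b≢c b∈A b∈B

  endsIn? : ∀ S ed → Dec (EndsIn S ed)
  endsIn? S ed = (src ed ∈ℕ? S) ×-dec (tgt ed ∈ℕ? S)

  -- The alternatives exclude each other because the sides share only `c` and the ends are distinct;
  -- `filter-partition` needs this to count each edge once.
  one-side : ∀ {s t} → s ∈ verts P → t ∈ verts P → s ≢ t → (s ≢ c → t ≢ c → Reach s t)
           → ((s ∈ c ∷ A × t ∈ c ∷ A) × ¬ (s ∈ c ∷ B × t ∈ c ∷ B))
           ⊎ ((s ∈ c ∷ B × t ∈ c ∷ B) × ¬ (s ∈ c ∷ A × t ∈ c ∷ A))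
  one-side {s} {t} s∈ t∈ s≢t r = Sum.map (λ inA → inA , exclusive inA) (λ inB → inB , λ inA → exclusive inA inB) sides
    where
    inA : ∀ {z} → Reach a z → z ∈ c ∷ A
    inA = there ∘ proj₂ (proj₂ isA) _
    inB : ∀ {z} → Reach b z → z ∈ c ∷ B
    inB = there ∘ proj₂ (proj₂ isB) _
    exclusive : s ∈ c ∷ A × t ∈ c ∷ A → ¬ (s ∈ c ∷ B × t ∈ c ∷ B)
    exclusive (sA , tA) (sB , tB) with s ≟ c
    ... | no s≢c = disjoint s≢c sA sB
    ... | yes refl = disjoint (s≢t ∘ sym) tA tB
    sides : (s ∈ c ∷ A × t ∈ c ∷ A) ⊎ (s ∈ c ∷ B × t ∈ c ∷ B)
    sides with s ≟ c | t ≟ c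
    ... | yes refl | _        = Sum.map (λ q → here refl , inA q) (λ q → here refl , inB q) (reachable t∈ (s≢t ∘ sym))
    ... | no s≢c   | yes refl = Sum.map (λ q → inA q , here refl) (λ q → inB q , here refl) (reachable s∈ s≢c)
    ... | no s≢c   | no t≢c   = Sum.map (λ q → inA q , inA (path-trans q (r s≢c t≢c)))
                                        (λ q → inB q , inB (path-trans q (r s≢c t≢c))) (reachable s∈ s≢c)

  eₚ : Edge
  eₚ = edgeOf P e

  rest : List Edge
  rest = removeAt (edges P) e

  f : Edge
  f = edge (virt ℓ) a c

  rest-sides : All (λ ed → (EndsIn (c ∷ A) ed × ¬ EndsIn (c ∷ B) ed) ⊎ (EndsIn (c ∷ B) ed × ¬ EndsIn (c ∷ A) ed)) rest
  rest-sides = All-removeAt (edges P) e λ i i≢e → let s , t , s≢t = All.lookup wf (∈-lookup i) in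
    one-side s t s≢t λ s≢c t≢c → step s≢c i i≢e (inj₁ (refl , refl)) (here t≢c)

  joins⇒∂ : ∀ v → ∂ eₚ v ≡ δ a v xor δ b v
  joins⇒∂ = Cycles.∂-joins P j

  -- `e` lies inside neither side: `b` is missing from one and `a` from the other.
  inside-rest : ∀ {S x} → x ∉ S → x ≡ a ⊎ x ≡ b → inside S (edges P) ↭ inside S rest
  inside-rest {S} {x} x∉S x-end = trans (filter-↭ (endsIn? S) (lookup-removeAt (edges P) e))
    (↭-reflexive (List.filter-reject (endsIn? S) (e-outside x-end j)))
    where
    e-outside : x ≡ a ⊎ x ≡ b → Joins P e a b → ¬ EndsIn S eₚ
    e-outside (inj₁ refl) (inj₁ (refl , refl)) (s , t) = x∉S s
    e-outside (inj₁ refl) (inj₂ (refl , refl)) (s , t) = x∉S t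
    e-outside (inj₂ refl) (inj₁ (refl , refl)) (s , t) = x∉S t
    e-outside (inj₂ refl) (inj₂ (refl , refl)) (s , t) = x∉S s

  inside-wf : ∀ S {V} → (∀ {x} → x ∈ S → x ∈ V)
            → All (λ ed → src ed ∈ V × tgt ed ∈ V × src ed ≢ tgt ed) (inside S (edges P))
  inside-wf S ⊆V = All.zipWith (λ ((s , t) , (_ , _ , s≢t)) → ⊆V s , ⊆V t , s≢t)
    (All.all-filter (endsIn? S) (edges P) , All.filter⁺ (endsIn? S) wf)

  e-wf : src eₚ ∈ a ∷ c ∷ B × tgt eₚ ∈ a ∷ c ∷ B × src eₚ ≢ tgt eₚ
  e-wf = let s , t = joins-elim {P} j (_∈ a ∷ c ∷ B) (here refl) (there b∈B) in
    s , t , proj₂ (proj₂ (All.lookup wf (∈-lookup e)))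

  avoids-inside : ∀ {v S} → v ∉ S → All (Avoids v) (inside S rest)
  avoids-inside {S = S} v∉S = EndsIn⇒Avoids v∉S (All.all-filter (endsIn? S) rest)

  twoSum : TwoSum P (graph (c ∷ A) (inside (c ∷ A) (edges P) ++ [ f ]))
                    (graph (a ∷ c ∷ B) (inside (c ∷ B) (edges P) ++ eₚ ∷ f ∷ []))
  twoSum = record
    { a≢b = proj₂ (proj₂ ends)
    ; a≢c = a≢c
    ; ∂e  = joins⇒∂
    ; ∂f  = λ _ → refl
    ; separated = record
      { apart = λ v v≢c → case v ∈ℕ? c ∷ A of λ where
          (no v∉)  → inj₁ (avoids-inside v∉)
          (yes v∈) → inj₂ (avoids-inside (disjoint v≢c v∈))
      ; a-off = avoids-inside a∉B
      ; b-off = avoids-inside b∉A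
      }
    ; P↭  = trans (lookup-removeAt (edges P) e) (prep eₚ
              (filter-partition (endsIn? (c ∷ A)) (endsIn? (c ∷ B)) rest-sides))
    ; H₁↭ = trans (++-comm (inside (c ∷ A) (edges P)) [ f ]) (prep f (inside-rest b∉A (inj₂ refl)))
    ; H₂↭ = trans (++-comm (inside (c ∷ B) (edges P)) (eₚ ∷ f ∷ []))
              (swap eₚ f (inside-rest a∉B (inj₁ refl)))
    ; wf₁ = All.++⁺ (inside-wf (c ∷ A) id) ((a∈A , here refl , a≢c) ∷ [])
    ; wf₂ = All.++⁺ (inside-wf (c ∷ B) there) (e-wf ∷ (here refl , there (here refl) , a≢c) ∷ [])
    }

splitOf⇒twoSum : ∀ {P ℓ H₁ H₂} → Edges-WF P → SplitOf P ℓ H₁ H₂ → TwoSum P H₁ H₂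
splitOf⇒twoSum {ℓ = ℓ} wf (_ , _ , sep , _ , _ , j , _ , _ , isA , isB , _ , refl , refl) =
  SplitStructure.twoSum wf ℓ sep j isA isB

-- Optimal decompositions along splits and merges

sum-↭-Pointwise : ∀ {A : Set} {R : A → ℕ → Set} {xs ys ks} → xs ↭ ys → Pointwise R xs ks
                → ∃[ ls ] (Pointwise R ys ls × sum ks ≡ sum ls)
sum-↭-Pointwise refl rs = -, rs , refl
sum-↭-Pointwise (prep x p) (_∷_ {y = k} r rs) with ls , rs' , eq ← sum-↭-Pointwise p rs =
  k ∷ ls , r ∷ rs' , cong (k +_) eq
sum-↭-Pointwise (swap x y p) (_∷_ {y = k} r (_∷_ {y = l} r' rs)) with ls , rs' , eq ← sum-↭-Pointwise p rs =
  l ∷ k ∷ ls , r' ∷ r ∷ rs' , ≡-trans (cong (λ n → k + (l + n)) eq) (+-swap k l (sum ls))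
  where
  +-swap : ∀ k l n → k + (l + n) ≡ l + (k + n)
  +-swap = solve-∀
sum-↭-Pointwise (trans p q) rs with ls , rs' , eq ← sum-↭-Pointwise p rs
  with ms , rs'' , eq' ← sum-↭-Pointwise q rs' = ms , rs'' , ≡-trans eq eq'

-- With the order as a parameter, `_≤_` gives the minimum and its converse the maximum.
module Optimum (_≼_ : ℕ → ℕ → Set) (≼-refl : ∀ {k} → k ≼ k) (≼-cancelʳ : ∀ k l n → (k + n) ≼ (l + n) → k ≼ l) where

  Optimal : List Edge → ℕ → Set
  Optimal es k = Decomposes es k × (∀ l → Decomposes es l → k ≼ l)

  IsOptimalCD : Graph → ℕ → Set
  IsOptimalCD G k = (∃[ D ] (IsCycleDecomposition G D × length D ≡ k))
                  × (∀ D → IsCycleDecomposition G D → k ≼ length D)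

  OptimalGraph : Graph → ℕ → Set
  OptimalGraph G k = Edges-WF G × Optimal (edges G) k

  optimal⇒CD : ∀ {G k} → OptimalGraph G k → IsOptimalCD G k
  optimal⇒CD {G} {k} (wf , d , best) =
      Cycles.circuits⇒cycles G (λ e → proj₂ (proj₂ (All.lookup wf (∈-lookup e)))) d
    , λ D isD → best (length D) (Cycles.cycles⇒circuits G D isD)

  cycleGraph-optimal : ∀ {G} → CycleGraph G → OptimalGraph G 1
  cycleGraph-optimal (wf , c) = wf , circuit-decomposes c ,
    λ l d → subst (1 ≼_) (sym (circuit-decomposes-once c d)) ≼-refl

  -- Exchange: a better decomposition of one part, joined with the given one of the other, would
  -- improve on the optimum of `P`.
  twoSum-optimal : ∀ {P H₁ H₂ k} → TwoSum P H₁ H₂ → Optimal (edges P) k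
    → ∃₂ λ k₁ k₂ → OptimalGraph H₁ k₁ × OptimalGraph H₂ k₂ × k + 1 ≡ k₁ + k₂
  twoSum-optimal {P} {H₁} {H₂} ts (d , best) with m , n , refl , d₁ , d₂ ← twoSum-split ts d =
    suc m , suc n , (TwoSum.wf₁ ts , d₁ , best₁) , (TwoSum.wf₂ ts , d₂ , best₂) , count m n
    where
    count : ∀ m n → suc (m + n) + 1 ≡ suc m + suc n
    count = solve-∀
    best₁ : ∀ l → Decomposes (edges H₁) l → suc m ≼ l
    best₁ l d' with m' , _ , refl , refl , d'' ← twoSum-join ts d' d₂ =
      ≼-cancelʳ (suc m) (suc m') n (best _ d'')
    best₂ : ∀ l → Decomposes (edges H₂) l → suc n ≼ l
    best₂ l d' with _ , n' , refl , refl , d'' ← twoSum-join ts d₁ d' =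
      ≼-cancelʳ (suc n) (suc n') m (subst₂ _≼_ (cong suc (ℕ.+-comm m n)) (cong suc (ℕ.+-comm m n')) (best _ d''))

  -- The formula of the theorem, free of subtraction, as an invariant of splitting.
  Balanced : ℕ → List Graph → Set
  Balanced k s = ∃[ ks ] (Pointwise OptimalGraph s ks × k + length s ≡ sum ks + 1)

  split-step : ∀ {k s s'} → SplitStep s s' → Balanced k s → Balanced k s'
  split-step {k} {s} (P , rest , ℓ , H₁ , H₂ , p , _ , sp , refl) (ks , rs , eq)
    with l ∷ ls , (wf , opt) ∷ rs' , eq' ← sum-↭-Pointwise p rs
    with k₁ , k₂ , o₁ , o₂ , eq'' ← twoSum-optimal (splitOf⇒twoSum wf sp) opt =
    k₁ ∷ k₂ ∷ ls , o₁ ∷ o₂ ∷ rs' , (begin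
      k + suc (suc (length rest))    ≡⟨ ℕ.+-suc k (suc (length rest)) ⟩
      suc (k + suc (length rest))    ≡⟨ cong (λ n → suc (k + n)) (sym (↭-length p)) ⟩
      suc (k + length s)             ≡⟨ cong suc (≡-trans eq (cong (_+ 1) eq')) ⟩
      suc (l + sum ls + 1)           ≡⟨ move l (sum ls) ⟩
      (l + 1) + sum ls + 1           ≡⟨ cong (λ n → n + sum ls + 1) eq'' ⟩
      (k₁ + k₂) + sum ls + 1         ≡⟨ cong (_+ 1) (ℕ.+-assoc k₁ k₂ (sum ls)) ⟩
      k₁ + (k₂ + sum ls) + 1         ∎)
    where
    open ≡-Reasoning
    move : ∀ l n → suc (l + n + 1) ≡ (l + 1) + n + 1
    move = solve-∀

  split-steps : ∀ {k s s'} → Star SplitStep s s' → Balanced k s → Balanced k s'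
  split-steps ε          = id
  split-steps (st ◅ sts) = split-steps sts ∘ split-step st

  drop-triangles : ∀ {ts os ks} → All IsTriangle ts → Pointwise OptimalGraph (ts ++ os) ks
    → All CycleGraph ts × ∃[ ls ] (Pointwise OptimalGraph os ls × sum ks ≡ length ts + sum ls)
  drop-triangles [] rs = [] , _ , rs , refl
  drop-triangles {T ∷ _} ((_ , three , _) ∷ tri) ((wf , d , _) ∷ rs)
    with cgs , ls , rs' , eq ← drop-triangles tri rs
    -- Evenness of the triangle comes from the decomposition it already has.
    with circuit ← triangle-circuit three (All.map (proj₂ ∘ proj₂) wf) (decomposes-even d) =
    (wf , circuit) ∷ cgs , ls , rs' , cong₂ _+_ (circuit-decomposes-once circuit d) eq

  add-cycleGraphs : ∀ {ts os ls} → All CycleGraph ts → Pointwise OptimalGraph os ls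
    → ∃[ ks ] (Pointwise OptimalGraph (ts ++ os) ks × sum ks ≡ length ts + sum ls)
  add-cycleGraphs []         rs = _ , rs , refl
  add-cycleGraphs (cg ∷ cgs) rs with ks , rs' , eq ← add-cycleGraphs cgs rs =
    1 ∷ ks , cycleGraph-optimal cg ∷ rs' , cong suc eq

  merge-steps : ∀ {ts ts'} → Star MergeStep ts ts' → All CycleGraph ts → All CycleGraph ts'
  merge-steps ε = id
  merge-steps ((P , Q , R , rest , p , glue , refl) ◅ sts) cgs
    with cP ∷ cQ ∷ cgs' ← All-resp-↭ p cgs = merge-steps sts (glue-cycleGraphs cP cQ glue ∷ cgs')

  components-optimal : ∀ {G k Cs} → OptimalGraph G k → TwoHalfConnectedComponents G Cs
    → ∃[ ks ] (Pointwise IsOptimalCD Cs ks × k + length Cs ≡ sum ks + 1)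
  components-optimal {k = k} opt (s , ts , os , ts' , (splits , _) , p , tri , _ , merges , _ , refl)
    with ks , rs , eq ← split-steps splits (k ∷ [] , opt ∷ [] , cong (_+ 1) (sym (ℕ.+-identityʳ k)))
    with ls , rs' , eq' ← sum-↭-Pointwise p rs
    with cgs , ms , rs'' , eq'' ← drop-triangles tri rs'
    with ns , rs''' , eq''' ← add-cycleGraphs (merge-steps merges cgs) rs'' =
    ns , Pointwise.map optimal⇒CD rs''' , (begin
      k + length (ts' ++ os)              ≡⟨ cong (k +_) (List.length-++ ts') ⟩
      k + (length ts' + length os)        ≡⟨ pull k (length ts') (length os) ⟩
      length ts' + (k + length os)        ≡⟨ cong (length ts' +_) (ℕ.+-cancelˡ-≡ (length ts) _ _ balance) ⟩
      length ts' + (sum ms + 1)           ≡⟨ sym (ℕ.+-assoc (length ts') (sum ms) 1) ⟩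
      length ts' + sum ms + 1             ≡⟨ cong (_+ 1) (sym eq''') ⟩
      sum ns + 1                          ∎)
    where
    open ≡-Reasoning
    pull : ∀ k m n → k + (m + n) ≡ m + (k + n)
    pull = solve-∀
    -- Each triangle adds 1 to both sides. After cancelling, the merged cycles are added in the same
    -- way, so their number may differ from that of the triangles.
    balance : length ts + (k + length os) ≡ length ts + (sum ms + 1)
    balance = begin
      length ts + (k + length os)    ≡⟨ sym (pull k (length ts) (length os)) ⟩
      k + (length ts + length os)    ≡⟨ cong (k +_) (sym (≡-trans (↭-length p) (List.length-++ ts))) ⟩
      k + length s                   ≡⟨ eq ⟩
      sum ks + 1                     ≡⟨ cong (_+ 1) (≡-trans eq' eq'') ⟩
      length ts + sum ms + 1         ≡⟨ ℕ.+-assoc (length ts) (sum ms) 1 ⟩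
      length ts + (sum ms + 1)       ∎

-- From even degrees to even edge multisets

odd : ℕ → Bool
odd zero    = false
odd (suc n) = not (odd n)

odd-+ : ∀ m n → odd (m + n) ≡ odd m xor odd n
odd-+ zero    n = refl
odd-+ (suc m) n = ≡-trans (cong not (odd-+ m n)) (Bool.not-distribˡ-xor (odd m) (odd n))

2∣⇒¬odd : ∀ {n} → 2 ∣ n → odd n ≡ false
2∣⇒¬odd (divides zero refl)    = refl
2∣⇒¬odd (divides (suc q) refl) = ≡-trans (Bool.not-involutive _) (2∣⇒¬odd (divides q refl))

odd-filter : ∀ (end : Edge → ℕ) v e es → odd (length (filter (λ ed → end ed ≟ v) (e ∷ es)))
           ≡ δ (end e) v xor odd (length (filter (λ ed → end ed ≟ v) es))
odd-filter end v e es with δ (end e) v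
... | true  = refl
... | false = refl

par-degree : ∀ V v es → par v es ≡ odd (degree (graph V es) v)
par-degree V v [] = refl
par-degree V v (e ∷ es) = begin
  (δ (src e) v xor δ (tgt e) v) xor par v es            ≡⟨ cong (∂ e v xor_) (≡-trans (par-degree V v es)
                                                             (odd-+ (count src es) (count tgt es))) ⟩
  (δ (src e) v xor δ (tgt e) v) xor (odd (count src es) xor odd (count tgt es))
                                                        ≡⟨ xor-interchange (δ (src e) v) (δ (tgt e) v) _ _ ⟩
  (δ (src e) v xor odd (count src es)) xor (δ (tgt e) v xor odd (count tgt es))
                                                        ≡⟨ sym (cong₂ _xor_ (odd-filter src v e es) (odd-filter tgt v e es)) ⟩
  odd (count src (e ∷ es)) xor odd (count tgt (e ∷ es)) ≡⟨ sym (odd-+ (count src (e ∷ es)) (count tgt (e ∷ es))) ⟩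
  odd (degree (graph V (e ∷ es)) v)                     ∎
  where
  open ≡-Reasoning
  count : (Edge → ℕ) → List Edge → ℕ
  count end es = length (filter (λ ed → end ed ≟ v) es)

-- `Eulerian` speaks of the vertices of `G`; any other name meets no edge.
eulerian⇒even : ∀ {G} → Edges-WF G → Eulerian G → Even (edges G)
eulerian⇒even {G} wf eul v with v ∈ℕ? verts G
... | yes v∈ = ≡-trans (par-degree (verts G) v (edges G)) (2∣⇒¬odd (eul v v∈))
... | no v∉  = par-avoid (EndsIn⇒Avoids v∉ (WF⇒EndsIn {G} wf))

module Min = Optimum _≤_ ℕ.≤-refl (λ k l n → ℕ.+-cancelʳ-≤ n k l)
module Max = Optimum (λ k l → l ≤ k) ℕ.≤-refl (λ k l n → ℕ.+-cancelʳ-≤ n l k)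

theorem10 : (G : Graph) → WF G → AllOriginal G → Biconnected G → Eulerian G
    → (Cs : List Graph) → TwoHalfConnectedComponents G Cs
    → (∃[ c ] ∃[ cs ] (IsMinCD G c × Pointwise IsMinCD Cs cs × c + length Cs ≡ sum cs + 1))
    × (∃[ n ] ∃[ ns ] (IsMaxCD G n × Pointwise IsMaxCD Cs ns × n + length Cs ≡ sum ns + 1))
theorem10 G (_ , wf) _ _ eul Cs comps
  -- One decomposition starts the searches: `least` looks below its size, `greatest` descends from
  -- the number of edges.
  with some ← even-decomposes _ (edges G) ℕ.≤-refl (eulerian⇒even {G} wf eul)
  with c , minimum ← least (λ k → decomposes? k (edges G)) (proj₁ some) (proj₂ some)
  with n , maximum ← greatest (λ k → decomposes? k (edges G)) _ (λ _ → decomposes-≤) some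
  with cs , cs-min , eq ← Min.components-optimal (wf , minimum) comps
  with ns , ns-max , eq' ← Max.components-optimal (wf , maximum) comps =
    (c , cs , Min.optimal⇒CD (wf , minimum) , cs-min , eq)
  , (n , ns , Max.optimal⇒CD (wf , maximum) , ns-max , eq')
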